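{- Let $G_1$ and $G_2$ be vertex-disjoint graphs on $n_1$ and $n_2$ vertices respectively. Then, as identities of rational functions in $x$: (a) $$\begin{aligned} f_{L(G_1\underset{=}{\vee}G_2)}(x)&=\det\big((x-n_1)I_{n_2}-L(G_2)\big)\,\det\big((x-n_1+1)I_{n_1}+D(G_1)\big)\\ &\cdot\det\Big((x-n_1-n_2+1)I_{n_1}-L(G_1)+D(G_1)-A(\overline{G_1})\big((x-n_1+1)I_{n_1}+D(G_1)\big)^{ -1}A(\overline{G_1})\Big)\\ &\cdot\Big[1-\Gamma_{L(G_2)}(x-n_1)\,\Gamma_{L(G_1)-D(G_1)+A(\overline{G_1})((x-n_1+1)I_{n_1}+D(G_1))^{ -1}A(\overline{G_1})}(x-n_1-n_2+1)\Big].\end{aligned}$$ (b) $$\begin{aligned} f_{L(G_1\veebar G_2)}(x)&=\det\big((x-n_1)I_{n_2}-L(G_2)\big)\,\det\big(xI_{n_1}-D(G_1)\big)\\ &\cdot\det\Big((x-n_2)I_{n_1}-L(G_1)-D(G_1)-A(G_1)\big(xI_{n_1}-D(G_1)\big)^{ -1}A(G_1)\Big)\\ &\cdot\Big[1-\Gamma_{L(G_2)}(x-n_1)\,\Gamma_{L(G_1)+D(G_1)+A(G_1)(xI_{n_1}-D(G_1))^{ -1}A(G_1)}(x-n_2)\Big].\end{aligned}$$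
   Context: Graphs are finite, undirected and simple. $A(G)$ is the adjacency matrix, $D(G)$ the diagonal matrix of vertex degrees, $L(G)=D(G)-A(G)$ the Laplacian matrix, and $\overline{G}$ the complement of $G$. For an $n\times n$ matrix $M$, $f_M(x)=\det(xI_n-M)$, and the coronal of $M$ is $\Gamma_M(y)=\mathbf 1_n^T(yI_n-M)^{ -1}\mathbf 1_n$, where $\mathbf 1_n$ is the all-ones column. When the entries of $M$ depend on $x$, $\Gamma_M(x-c)$ means $\mathbf 1_n^T((x-c)I_n-M)^{ -1}\mathbf 1_n$ with that same $x$. Let $V(G_1)=\{u_1,\dots,u_{n_1}\}$. The join $G_1\vee G_2$ is the disjoint union of $G_1$ and $G_2$ together with all edges between $V(G_1)$ and $V(G_2)$. The NS (Neighbors Splitting) join $G_1\veebar G_2$ is obtained from $G_1\vee G_2$ by adding new vertices $u_1',\dots,u_{n_1}'$ and joining $u_i'$ to $u_j$ if and only if $u_iu_j\in E(G_1)$. The NNS (Non Neighbors Splitting) join $G_1\underset{=}{\vee}G_2$ is obtained from $G_1\vee G_2$ by adding new vertices $u_1',\dots,u_{n_1}'$ and joining $u_i'$ to $u_j$ if and only if $i\ne j$ and $u_iu_j\notin E(G_1)$. -}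

module Defs where

open import Algebra.Bundles using (RawRing)
import Algebra.Definitions as AlgebraDefinitions
import Algebra.Definitions.RawSemiring as RawSemiringDefinitions
open import Data.Bool.Base using (Bool; true; false; not; _∧_; if_then_else_)
open import Data.Fin.Base using (Fin; zero; suc; toℕ; punchIn; splitAt)
open import Data.Fin.Properties using (_≟_)
open import Data.Fin.Subset using (∣_∣)
open import Data.List.Base using (List; []; _∷_; map)
open import Data.Nat.Base as ℕ using (ℕ; zero; suc)
open import Data.Product.Base using (∃-syntax; _×_; _,_; proj₁)
open import Data.Rational.Base as ℚ using (ℚ; 0ℚ; 1ℚ)
import Data.Rational.Properties as ℚₚ
open import Data.Sum.Base using (_⊎_; inj₁; inj₂; [_,_]′)
open import Data.Vec.Base using (tabulate)
open import Function.Base using (const)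
open import Function.Bundles using (mk⇔)
open import Level using (0ℓ)
open import Relation.Binary.PropositionalEquality
  using (_≡_; _≢_; refl; sym; trans; cong; cong₂; module ≡-Reasoning)
open import Relation.Nullary.Decidable using (does; yes; no; does-⇔; dec-true)
open import Relation.Nullary.Negation using (contradiction)

------------------------------------------------------------------------
-- Finite simple graphs

record Graph (n : ℕ) : Set where
  field
    adj        : Fin n → Fin n → Bool
    adj-sym    : ∀ i j → adj i j ≡ adj j i
    adj-irrefl : ∀ i → adj i i ≡ false

open Graph public

degree : ∀ {n} → Graph n → Fin n → ℕ
degree G i = ∣ tabulate (adj G i) ∣

distinctNonAdj : ∀ {n} → Graph n → Fin n → Fin n → Bool
distinctNonAdj G i j = not (does (i ≟ j)) ∧ not (adj G i j)

complement : ∀ {n} → Graph n → Graph n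
complement G = record
  { adj        = distinctNonAdj G
  ; adj-sym    = λ i j → cong₂ (λ a b → not a ∧ not b)
                   (does-⇔ (mk⇔ sym sym) (i ≟ j) (j ≟ i)) (adj-sym G i j)
  ; adj-irrefl = λ i → cong (λ a → not a ∧ not (adj G i i))
                   (dec-true (i ≟ i) refl)
  }

-- In a graph on m + n vertices, splitAt m identifies the first m of them
-- with Fin m and the remaining n with Fin n.

infixr 6 _∨_ _NS∨_ _NNS∨_

_∨_ : ∀ {m n} → Graph m → Graph n → Graph (m ℕ.+ n)
_∨_ {m} {n} G H = record
  { adj        = λ v w → E (splitAt m v) (splitAt m w)
  ; adj-sym    = λ v w → E-sym (splitAt m v) (splitAt m w)
  ; adj-irrefl = λ v → E-irrefl (splitAt m v)
  }
  where
  E : Fin m ⊎ Fin n → Fin m ⊎ Fin n → Bool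
  E (inj₁ i) (inj₁ j) = adj G i j
  E (inj₁ _) (inj₂ _) = true
  E (inj₂ _) (inj₁ _) = true
  E (inj₂ k) (inj₂ l) = adj H k l

  E-sym : ∀ v w → E v w ≡ E w v
  E-sym (inj₁ i) (inj₁ j) = adj-sym G i j
  E-sym (inj₁ _) (inj₂ _) = refl
  E-sym (inj₂ _) (inj₁ _) = refl
  E-sym (inj₂ k) (inj₂ l) = adj-sym H k l

  E-irrefl : ∀ v → E v v ≡ false
  E-irrefl (inj₁ i) = adj-irrefl G i
  E-irrefl (inj₂ k) = adj-irrefl H k

-- Adds k new, pairwise non-adjacent vertices; the i-th of them is joined
-- to the old vertex v precisely when N i v is true.

addVertices : ∀ {m k} → Graph m → (Fin k → Fin m → Bool) → Graph (m ℕ.+ k)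
addVertices {m} {k} G N = record
  { adj        = λ v w → E (splitAt m v) (splitAt m w)
  ; adj-sym    = λ v w → E-sym (splitAt m v) (splitAt m w)
  ; adj-irrefl = λ v → E-irrefl (splitAt m v)
  }
  where
  E : Fin m ⊎ Fin k → Fin m ⊎ Fin k → Bool
  E (inj₁ v) (inj₁ w) = adj G v w
  E (inj₁ v) (inj₂ i) = N i v
  E (inj₂ i) (inj₁ v) = N i v
  E (inj₂ _) (inj₂ _) = false

  E-sym : ∀ v w → E v w ≡ E w v
  E-sym (inj₁ v) (inj₁ w) = adj-sym G v w
  E-sym (inj₁ _) (inj₂ _) = refl
  E-sym (inj₂ _) (inj₁ _) = refl
  E-sym (inj₂ _) (inj₂ _) = refl

  E-irrefl : ∀ v → E v v ≡ false
  E-irrefl (inj₁ v) = adj-irrefl G v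
  E-irrefl (inj₂ _) = refl

_NS∨_ : ∀ {n₁ n₂} → Graph n₁ → Graph n₂ → Graph ((n₁ ℕ.+ n₂) ℕ.+ n₁)
_NS∨_ {n₁} G₁ G₂ = addVertices (G₁ ∨ G₂)
  λ i v → [ adj G₁ i , const false ]′ (splitAt n₁ v)

_NNS∨_ : ∀ {n₁ n₂} → Graph n₁ → Graph n₂ → Graph ((n₁ ℕ.+ n₂) ℕ.+ n₁)
_NNS∨_ {n₁} G₁ G₂ = addVertices (G₁ ∨ G₂)
  λ i v → [ distinctNonAdj G₁ i , const false ]′ (splitAt n₁ v)

------------------------------------------------------------------------
-- Polynomials over ℚ: a₀ ∷ a₁ ∷ … ∷ [] stands for a₀ + a₁X + …, and
-- trailing zeros are ignored by _≈ₚ_.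

Poly : Set
Poly = List ℚ

coeff : Poly → ℕ → ℚ
coeff []      _       = 0ℚ
coeff (a ∷ p) zero    = a
coeff (a ∷ p) (suc k) = coeff p k

infix  4 _≈ₚ_
infixl 6 _+ₚ_
infixl 7 _*ₚ_ _·ₚ_

_≈ₚ_ : Poly → Poly → Set
p ≈ₚ q = ∀ k → coeff p k ≡ coeff q k

_+ₚ_ : Poly → Poly → Poly
[]      +ₚ q       = q
(a ∷ p) +ₚ []      = a ∷ p
(a ∷ p) +ₚ (b ∷ q) = a ℚ.+ b ∷ p +ₚ q

-ₚ_ : Poly → Poly
-ₚ_ = map (ℚ.-_)

_·ₚ_ : ℚ → Poly → Poly
a ·ₚ p = map (a ℚ.*_) p

_*ₚ_ : Poly → Poly → Poly
[]      *ₚ q = []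
(a ∷ p) *ₚ q = a ·ₚ q +ₚ (0ℚ ∷ p *ₚ q)

NonZeroₚ : Poly → Set
NonZeroₚ p = ∃[ k ] coeff p k ≢ 0ℚ

private
  coeff-+ : ∀ p q k → coeff (p +ₚ q) k ≡ coeff p k ℚ.+ coeff q k
  coeff-+ []      q       k       = sym (ℚₚ.+-identityˡ _)
  coeff-+ (a ∷ p) []      k       = sym (ℚₚ.+-identityʳ _)
  coeff-+ (a ∷ p) (b ∷ q) zero    = refl
  coeff-+ (a ∷ p) (b ∷ q) (suc k) = coeff-+ p q k

  coeff-· : ∀ a p k → coeff (a ·ₚ p) k ≡ a ℚ.* coeff p k
  coeff-· a []      k       = sym (ℚₚ.*-zeroʳ a)
  coeff-· a (b ∷ p) zero    = refl
  coeff-· a (b ∷ p) (suc k) = coeff-· a p k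

  +ₚ-congˡ : ∀ p {q r} → q ≈ₚ r → p +ₚ q ≈ₚ p +ₚ r
  +ₚ-congˡ p {q} {r} q≈r k =
    trans (coeff-+ p q k)
      (trans (cong (coeff p k ℚ.+_) (q≈r k)) (sym (coeff-+ p r k)))

  ∷-cong : ∀ {a b p q} → a ≡ b → p ≈ₚ q → (a ∷ p) ≈ₚ (b ∷ q)
  ∷-cong a≡b p≈q zero    = a≡b
  ∷-cong a≡b p≈q (suc k) = p≈q k

  *ₚ-shiftʳ : ∀ p q → p *ₚ (0ℚ ∷ q) ≈ₚ (0ℚ ∷ p *ₚ q)
  *ₚ-shiftʳ []      q zero    = refl
  *ₚ-shiftʳ []      q (suc k) = refl
  *ₚ-shiftʳ (a ∷ p) q = ∷-cong
    (trans (ℚₚ.+-identityʳ _) (ℚₚ.*-zeroʳ a))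
    (+ₚ-congˡ (a ·ₚ q) (*ₚ-shiftʳ p q))

  NonZeroₚ-resp : ∀ {p q} → p ≈ₚ q → NonZeroₚ p → NonZeroₚ q
  NonZeroₚ-resp p≈q (k , p≢0) = k , λ q≡0 → p≢0 (trans (p≈q k) q≡0)

  a*b≢0 : ∀ {a b} → a ≢ 0ℚ → b ≢ 0ℚ → a ℚ.* b ≢ 0ℚ
  a*b≢0 {a} {b} a≢0 b≢0 ab≡0 = b≢0 (begin
    b                      ≡⟨ ℚₚ.*-identityˡ b ⟨
    1ℚ ℚ.* b               ≡⟨ cong (ℚ._* b) (ℚₚ.*-inverseˡ a) ⟨
    ℚ.1/ a ℚ.* a ℚ.* b     ≡⟨ ℚₚ.*-assoc (ℚ.1/ a) a b ⟩
    ℚ.1/ a ℚ.* (a ℚ.* b)   ≡⟨ cong (ℚ.1/ a ℚ.*_) ab≡0 ⟩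
    ℚ.1/ a ℚ.* 0ℚ          ≡⟨ ℚₚ.*-zeroʳ (ℚ.1/ a) ⟩
    0ℚ                     ∎)
    where
    open ≡-Reasoning
    instance _ = ℚ.≢-nonZero a≢0

  shiftˡ : ∀ {a} p q → a ≡ 0ℚ → NonZeroₚ (p *ₚ q) → NonZeroₚ ((a ∷ p) *ₚ q)
  shiftˡ p q refl (k , pq≢0) = suc k , λ eq → pq≢0 (begin
    coeff (p *ₚ q) k
      ≡⟨ ℚₚ.+-identityˡ _ ⟨
    0ℚ ℚ.+ coeff (p *ₚ q) k
      ≡⟨ cong (ℚ._+ coeff (p *ₚ q) k) (ℚₚ.*-zeroˡ (coeff q (suc k))) ⟨
    0ℚ ℚ.* coeff q (suc k) ℚ.+ coeff (p *ₚ q) k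
      ≡⟨ cong (ℚ._+ coeff (p *ₚ q) k) (coeff-· 0ℚ q (suc k)) ⟨
    coeff (0ℚ ·ₚ q) (suc k) ℚ.+ coeff (p *ₚ q) k
      ≡⟨ coeff-+ (0ℚ ·ₚ q) (0ℚ ∷ p *ₚ q) (suc k) ⟨
    coeff ((0ℚ ∷ p) *ₚ q) (suc k)
      ≡⟨ eq ⟩
    0ℚ ∎)
    where open ≡-Reasoning

  unitˡ : ∀ {a} p q → a ≢ 0ℚ → NonZeroₚ q → NonZeroₚ ((a ∷ p) *ₚ q)
  unitˡ p [] a≢0 (k , q≢0) = contradiction refl q≢0
  unitˡ {a} p (b ∷ q) a≢0 (k , q≢0) with b ℚₚ.≟ 0ℚ | k
  ... | no  b≢0  | _     = 0 , λ eq → a*b≢0 a≢0 b≢0 (trans (sym (ℚₚ.+-identityʳ _)) eq)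
  ... | yes b≡0  | zero  = contradiction b≡0 q≢0
  ... | yes refl | suc j with unitˡ p q a≢0 (j , q≢0)
  ...   | (i , pq≢0) = NonZeroₚ-resp
    {0ℚ ∷ (a ∷ p) *ₚ q} {(a ∷ p) *ₚ (0ℚ ∷ q)}
    (λ l → sym (*ₚ-shiftʳ (a ∷ p) q l)) (suc i , pq≢0)

*ₚ-nonZero : ∀ p q → NonZeroₚ p → NonZeroₚ q → NonZeroₚ (p *ₚ q)
*ₚ-nonZero []      q (k , p≢0) q≢0 = contradiction refl p≢0
*ₚ-nonZero (a ∷ p) q (k , p≢0) q≢0 with a ℚₚ.≟ 0ℚ | k
... | no  a≢0 | _     = unitˡ p q a≢0 q≢0
... | yes a≡0 | zero  = contradiction a≡0 p≢0
... | yes a≡0 | suc j = shiftˡ p q a≡0 (*ₚ-nonZero p q (j , p≢0) q≢0)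

------------------------------------------------------------------------
-- The field ℚ(X) of rational functions, as formal quotients of polynomials

record RatFun : Set where
  constructor _/_[_]
  field
    num     : Poly
    den     : Poly
    den-nz  : NonZeroₚ den

open RatFun public

polynomial : Poly → RatFun
polynomial p = p / (1ℚ ∷ []) [ 0 , (λ ()) ]

ℚ⟨X⟩ : RawRing 0ℓ 0ℓ
ℚ⟨X⟩ = record
  { Carrier = RatFun
  ; _≈_     = λ f g → num f *ₚ den g ≈ₚ num g *ₚ den f
  ; _+_     = λ f g → (num f *ₚ den g +ₚ num g *ₚ den f)
                      / (den f *ₚ den g) [ *ₚ-nonZero (den f) (den g) (den-nz f) (den-nz g) ]
  ; _*_     = λ f g → (num f *ₚ num g)
                      / (den f *ₚ den g) [ *ₚ-nonZero (den f) (den g) (den-nz f) (den-nz g) ]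
  ; -_      = λ f → (-ₚ num f) / den f [ den-nz f ]
  ; 0#      = polynomial []
  ; 1#      = polynomial (1ℚ ∷ [])
  }

X : RatFun
X = polynomial (0ℚ ∷ 1ℚ ∷ [])

------------------------------------------------------------------------
-- Matrices

module Matrices {c ℓ} (R : RawRing c ℓ) where

  open RawRing R public using (Carrier; _≈_; _+_; _*_; -_; 0#; 1#)
  open RawSemiringDefinitions (RawRing.rawSemiring R) public
    using (sum; _^_) renaming (_×_ to _×ᴿ_)

  infixl 6 _-_ _+ᴹ_ _-ᴹ_
  infixl 7 _*ᴹ_
  infix  9 _·I
  infix  4 _≈ᴹ_

  _-_ : Carrier → Carrier → Carrier
  a - b = a + (- b)

  ι : ℕ → Carrier
  ι n = n ×ᴿ 1#

  Matrix : ℕ → ℕ → Set c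
  Matrix m n = Fin m → Fin n → Carrier

  _≈ᴹ_ : ∀ {m n} → Matrix m n → Matrix m n → Set ℓ
  M ≈ᴹ N = ∀ i j → M i j ≈ N i j

  _+ᴹ_ _-ᴹ_ : ∀ {m n} → Matrix m n → Matrix m n → Matrix m n
  (M +ᴹ N) i j = M i j + N i j
  (M -ᴹ N) i j = M i j - N i j

  _*ᴹ_ : ∀ {l m n} → Matrix l m → Matrix m n → Matrix l n
  (M *ᴹ N) i k = sum λ j → M i j * N j k

  diagonal : ∀ {n} → (Fin n → Carrier) → Matrix n n
  diagonal d i j = if does (i ≟ j) then d i else 0#

  _·I : ∀ {n} → Carrier → Matrix n n
  a ·I = diagonal (const a)

  -- Laplace expansion along the first row.
  det : ∀ {n} → Matrix n n → Carrier
  det {zero}  M = 1#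
  det {suc n} M = sum λ j →
    (- 1#) ^ toℕ j * M zero j * det (λ i k → M (suc i) (punchIn j k))

  Invertible : ∀ {n} → Matrix n n → Set _
  Invertible = AlgebraDefinitions.Invertible _≈ᴹ_ (1# ·I) _*ᴹ_

  -- The matrix need not be written out: it is determined by the proof.
  _⁻¹ : ∀ {n} {M : Matrix n n} → Invertible M → Matrix n n
  M-inv ⁻¹ = proj₁ M-inv

  -- The coronal 1ᵀ (yI − M)⁻¹ 1, a 1 × 1 matrix read as a scalar.
  Γ : ∀ {n} (M : Matrix n n) (y : Carrier) → Invertible (y ·I -ᴹ M) → Carrier
  Γ M y yI-M-inv = (𝟏ᵀ *ᴹ yI-M-inv ⁻¹ *ᴹ 𝟏) zero zero
    where
    𝟏 : Matrix _ 1
    𝟏 _ _ = 1#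
    𝟏ᵀ : Matrix 1 _
    𝟏ᵀ _ _ = 1#

  A : ∀ {n} → Graph n → Matrix n n
  A G i j = if adj G i j then 1# else 0#

  D : ∀ {n} → Graph n → Matrix n n
  D G = diagonal (λ i → ι (degree G i))

  L : ∀ {n} → Graph n → Matrix n n
  L G = D G -ᴹ A G

open Matrices ℚ⟨X⟩ public

-- The characteristic polynomial f_M evaluated at the indeterminate X.
f : ∀ {n} → Matrix n n → RatFun
f M = det (X ·I -ᴹ M)

{-# OPTIONS --safe #-}

-- Order the vertices of the splitting join as V(G₁), V(G₂), V′. Then xI - L is the block matrix
--
--   U  J  E
--   J  V  0
--   Eᵀ 0  P
--
-- where E is the adjacency matrix of G₁ or of its complement, and J is all ones. The Schur complement
-- of P replaces U by S = U - E P⁻¹ E, that of V then subtracts the coronal of V from every entry of S,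
-- and det (S - γ 11ᵀ) = det S (1 - γ 1ᵀ S⁻¹ 1). The blocks V and P and the matrix with blocks U, E, E, P
-- are invertible over ℚ(X) because their determinants are monic polynomials; S is invertible because
-- its determinant is the quotient of two of these.

module Submission where

open import Algebra.Bundles using (AbelianGroup; CommutativeRing; RawRing)
import Algebra.Solver.CommutativeMonoid as CommutativeMonoidSolver
open import Data.Bool.Base using (Bool; true; false; not; _∧_; if_then_else_)
open import Data.Fin.Base using (Fin; zero; suc; toℕ; punchIn; splitAt; _↑ˡ_; _↑ʳ_)
open import Data.Fin.Properties
  using (_≟_; suc-injective; ↑ˡ-injective; ↑ʳ-injective; splitAt-↑ˡ; splitAt-↑ʳ; join-splitAt; toℕ-↑ˡ)
open import Data.Fin.Subset using (∣_∣)
open import Data.Nat.Base as ℕ using (ℕ; zero; suc)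
import Data.Nat.Properties as ℕₚ
open import Data.Product.Base using (Σ-syntax; _×_; _,_; proj₁; proj₂)
open import Data.Rational.Base as ℚ using (ℚ; 0ℚ; 1ℚ)
import Data.Rational.Properties as ℚₚ
open import Data.Sum.Base using (inj₁; inj₂; [_,_]′)
open import Data.Vec.Base using (tabulate)
open import Data.Vec.Functional using (Vector; _++_; tail; updateAt)
open import Data.Vec.Functional.Properties
  using (updateAt-updates; updateAt-minimal; lookup-++ˡ; lookup-++ʳ)
open import Data.Vec.Properties using (tabulate-cong)
open import Defs using
  ( module Matrices; Graph; adj; adj-sym; adj-irrefl; degree; complement; addVertices; _∨_; _NS∨_; _NNS∨_
  ; Poly; coeff; _≈ₚ_; _+ₚ_; -ₚ_; _·ₚ_; _*ₚ_; NonZeroₚ; *ₚ-nonZero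
  ; RatFun; _/_[_]; num; den; den-nz; polynomial; ℚ⟨X⟩; X
  )
open import Function.Base using (const; _∘_; case_of_)
open import Function.Bundles using (mk⇔)
open import Level using (0ℓ; _⊔_)
open import Relation.Binary.PropositionalEquality as ≡ using (_≡_; _≢_)
open import Relation.Binary.Structures using (IsEquivalence)
open import Relation.Nullary.Decidable using (does; does-⇔; dec-false; decidable-stable; yes; no)
open import Relation.Nullary.Negation using (¬_; contradiction)

-- The coronal `Γ` takes a proof of invertibility as an argument, so the inverses belong to the
-- conclusion and have to be exhibited. Entries are formal fractions compared by
-- cross-multiplication. Determinants, block matrices and Laplacians are therefore treated over an
-- arbitrary commutative ring, and ℚ(X) enters only as a ring in which monic elements have inverses.
--
-- Since `det` is the Laplace expansion along the first row, its multiplicativity has to be earned.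
-- It comes from the uniqueness of alternating multilinear functions of the rows: for fixed N, the
-- function sending M to det (MN) is one of these, so it equals det M times its value det N at I.
--
-- Monicity is tracked by a relation between a ring element and its coefficient at a given power of
-- X. Laplace expansion respects this relation, so the coefficient of Xⁿ in an n × n determinant is
-- the determinant, over the coefficient field, of the matrix of X-coefficients. For the matrices
-- concerned that matrix is the identity.

module Determinants {c ℓ} (R : CommutativeRing c ℓ) where

  open CommutativeRing R hiding (_-_; zero)
  open Matrices rawRing hiding (Carrier; _≈_; _+_; _*_; -_; 0#; 1#)
  open import Algebra.Properties.Ring ring
    using (-1*x≈-x; -‿involutive; -0#≈0#; +-inverseˡ-unique; //-rightDividesˡ)
  open import Algebra.Properties.Semiring.Sum semiring
    using (sum-cong-≋; sum-replicate-zero; sum-remove; ∑-distrib-+; ∑-comm; *-distribˡ-sum; *-distribʳ-sum)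
  open import Algebra.Solver.Ring.NaturalCoefficients.Default commutativeSemiring
    using (solve; _:=_; _:+_; _:*_; con)
  open import Data.Vec.Functional using (_∷_)
  open import Relation.Binary.Reasoning.Setoid setoid

  -- Finite sums and matrix algebra over a commutative ring

  sum-zero : ∀ {n} {x : Vector Carrier n} → (∀ i → x i ≈ 0#) → sum x ≈ 0#
  sum-zero {n} x≈0 = trans (sum-cong-≋ x≈0) (sum-replicate-zero n)

  sum-linear : ∀ {n} a (x y : Vector Carrier n) →
               sum (λ i → a * x i + y i) ≈ a * sum x + sum y
  sum-linear a x y =
    trans (∑-distrib-+ (λ i → a * x i) y) (+-congʳ (sym (*-distribˡ-sum a x)))

  sum-++ : ∀ m {n} (x : Vector Carrier (m ℕ.+ n)) →
           sum x ≈ sum (λ i → x (i ↑ˡ n)) + sum (λ j → x (m ↑ʳ j))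
  sum-++ zero    x = sym (+-identityˡ _)
  sum-++ (suc m) x = trans (+-congˡ (sum-++ m (tail x))) (sym (+-assoc _ _ _))

  I : ∀ {n} → Matrix n n
  I = 1# ·I

  sum-diagonalˡ : ∀ {n} (d x : Vector Carrier n) i →
                  sum (λ j → diagonal d i j * x j) ≈ d i * x i
  sum-diagonalˡ d x zero    =
    trans (+-congˡ (sum-zero λ j → zeroˡ (x (suc j)))) (+-identityʳ _)
  sum-diagonalˡ d x (suc i) =
    trans (+-cong (zeroˡ (x zero)) (sum-diagonalˡ (tail d) (tail x) i)) (+-identityˡ _)

  sum-diagonalʳ : ∀ {n} (d x : Vector Carrier n) k →
                  sum (λ j → x j * diagonal d j k) ≈ x k * d k
  sum-diagonalʳ d x zero    =
    trans (+-congˡ (sum-zero λ j → zeroʳ (x (suc j)))) (+-identityʳ _)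
  sum-diagonalʳ d x (suc k) =
    trans (+-cong (zeroʳ (x zero)) (sum-diagonalʳ (tail d) (tail x) k)) (+-identityˡ _)

  0ᴹ : ∀ {m n} → Matrix m n
  0ᴹ _ _ = 0#

  *ᴹ-cong : ∀ {l m n} {M M′ : Matrix l m} {N N′ : Matrix m n} →
            M ≈ᴹ M′ → N ≈ᴹ N′ → M *ᴹ N ≈ᴹ M′ *ᴹ N′
  *ᴹ-cong M≈ N≈ i k = sum-cong-≋ λ j → *-cong (M≈ i j) (N≈ j k)

  *ᴹ-assoc : ∀ {k l m n} (M : Matrix k l) (N : Matrix l m) (K : Matrix m n) →
             (M *ᴹ N) *ᴹ K ≈ᴹ M *ᴹ (N *ᴹ K)
  *ᴹ-assoc M N K i j = begin
    sum (λ r → sum (λ s → M i s * N s r) * K r j)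
      ≈⟨ sum-cong-≋ (λ r → *-distribʳ-sum (K r j) (λ s → M i s * N s r)) ⟩
    sum (λ r → sum (λ s → M i s * N s r * K r j))
      ≈⟨ ∑-comm (λ r s → M i s * N s r * K r j) ⟩
    sum (λ s → sum (λ r → M i s * N s r * K r j))
      ≈⟨ sum-cong-≋ (λ s → sum-cong-≋ λ r → *-assoc (M i s) (N s r) (K r j)) ⟩
    sum (λ s → sum (λ r → M i s * (N s r * K r j)))
      ≈⟨ sum-cong-≋ (λ s → *-distribˡ-sum (M i s) (λ r → N s r * K r j)) ⟨
    sum (λ s → M i s * sum (λ r → N s r * K r j))
      ∎

  *ᴹ-identityˡ : ∀ {m n} (M : Matrix m n) → I *ᴹ M ≈ᴹ M
  *ᴹ-identityˡ M i k = trans (sum-diagonalˡ (const 1#) (λ j → M j k) i) (*-identityˡ _)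

  *ᴹ-identityʳ : ∀ {m n} (M : Matrix m n) → M *ᴹ I ≈ᴹ M
  *ᴹ-identityʳ M i k = trans (sum-diagonalʳ (const 1#) (M i) k) (*-identityʳ _)

  *ᴹ-zeroˡ : ∀ {l m n} (M : Matrix m n) → 0ᴹ {l} *ᴹ M ≈ᴹ 0ᴹ
  *ᴹ-zeroˡ M i k = sum-zero λ j → zeroˡ (M j k)

  *ᴹ-zeroʳ : ∀ {l m n} (M : Matrix l m) → M *ᴹ 0ᴹ {n = n} ≈ᴹ 0ᴹ
  *ᴹ-zeroʳ M i k = sum-zero λ j → zeroʳ (M i j)

  -- Alternating multilinear functions of the rows

  AgreeOff : ∀ {n p} → Fin n → Matrix n p → Matrix n p → Set ℓ
  AgreeOff i M N = ∀ k → k ≢ i → ∀ j → M k j ≈ N k j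

  -- Additivity and homogeneity are one axiom. The matrices enter it through agreement off row i
  -- rather than as row updates of a given matrix, so that it applies to every presentation of such
  -- a matrix, in particular to minors and products.
  record IsAlternating {n p} (F : Matrix n p → Carrier) : Set (c ⊔ ℓ) where
    field
      cong        : ∀ {M N} → M ≈ᴹ N → F M ≈ F N
      linear      : ∀ i a {M N K} → AgreeOff i M K → AgreeOff i N K →
                    (∀ j → K i j ≈ a * M i j + N i j) → F K ≈ a * F M + F N
      alternating : ∀ {i j M} → i ≢ j → (∀ k → M i k ≈ M j k) → F M ≈ 0#

  setRow : ∀ {n p} → Fin n → Vector Carrier p → Matrix n p → Matrix n p
  setRow i r M = updateAt M i (const r)

  setRow-at : ∀ {n p} i {r} {M : Matrix n p} → ∀ k → setRow i r M i k ≈ r k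
  setRow-at i {r} {M} k = reflexive (≡.cong-app (updateAt-updates i M) k)

  setRow-off : ∀ {n p} i {r} {M : Matrix n p} → AgreeOff i (setRow i r M) M
  setRow-off i {r} {M} k k≢i j = reflexive (≡.cong-app (updateAt-minimal k i M k≢i) j)

  module Alternating {n p} {F : Matrix n p → Carrier} (F-alt : IsAlternating F) where
    open IsAlternating F-alt public

    -- A zero row r satisfies r = -r + r, so linearity with coefficient -1 and three equal matrices
    -- gives F M = -F M + F M.
    zero-row : ∀ {M} i → (∀ j → M i j ≈ 0#) → F M ≈ 0#
    zero-row {M} i Mᵢ≈0 = begin
      F M               ≈⟨ linear i (- 1#) {M} {M} {M} (λ _ _ _ → refl) (λ _ _ _ → refl) row ⟩
      - 1# * F M + F M  ≈⟨ +-congʳ (-1*x≈-x (F M)) ⟩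
      - F M + F M       ≈⟨ -‿inverseˡ (F M) ⟩
      0#                ∎
      where
      row : ∀ j → M i j ≈ - 1# * M i j + M i j
      row j = sym (trans (+-congʳ (trans (*-congˡ (Mᵢ≈0 j)) (zeroʳ (- 1#)))) (+-identityˡ _))

    -- By induction on the number of summands: `M′` carries the remaining ones in row i, and the
    -- empty sum is a zero row.
    row-sum : ∀ {q M} i (a : Vector Carrier q) (N : Fin q → Matrix n p) →
              (∀ r → AgreeOff i (N r) M) → (∀ j → M i j ≈ sum λ r → a r * N r i j) →
              F M ≈ sum λ r → a r * F (N r)
    row-sum {zero}      i a N N≈M Mᵢ = zero-row i Mᵢ
    row-sum {suc q} {M} i a N N≈M Mᵢ = begin
      F M                                         ≈⟨ linear i (a zero) (N≈M zero) (setRow-off i) row ⟩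
      a zero * F (N zero) + F M′                  ≈⟨ +-congˡ (row-sum i (tail a) (tail N) agree (setRow-at i)) ⟩
      a zero * F (N zero) + sum (λ r → a (suc r) * F (N (suc r))) ∎
      where
      rest : Vector Carrier p
      rest j = sum λ r → a (suc r) * N (suc r) i j
      M′ : Matrix n p
      M′ = setRow i rest M
      row : ∀ j → M i j ≈ a zero * N zero i j + M′ i j
      row j = trans (Mᵢ j) (+-congˡ (sym (setRow-at i j)))
      agree : ∀ r → AgreeOff i (N (suc r)) M′
      agree r k k≢i j = trans (N≈M (suc r) k k≢i j) (sym (setRow-off i k k≢i j))

    add-row : ∀ {i j M N} a → i ≢ j → AgreeOff i N M →
              (∀ k → M i k ≈ a * M j k + N i k) → F M ≈ F N
    add-row {i} {j} {M} {N} a i≢j N≈M Mᵢ = begin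
      F M
        ≈⟨ linear i a (setRow-off i) N≈M (λ k → trans (Mᵢ k) (+-congʳ (*-congˡ (sym (setRow-at i k))))) ⟩
      a * F (setRow i (M j) M) + F N
        ≈⟨ +-congʳ (trans (*-congˡ (alternating i≢j same)) (zeroʳ a)) ⟩
      0# + F N
        ≈⟨ +-identityˡ (F N) ⟩
      F N ∎
      where
      same : ∀ k → setRow i (M j) M i k ≈ setRow i (M j) M j k
      same k = trans (setRow-at i k) (sym (setRow-off i j (i≢j ∘ ≡.sym) k))

    -- F vanishes when rows i and j are both replaced by Mᵢ + Mⱼ.
    swap-rows : ∀ {i j M N} → i ≢ j → (∀ k → N i k ≈ M j k) → (∀ k → N j k ≈ M i k) →
                (∀ l → l ≢ i → l ≢ j → ∀ k → N l k ≈ M l k) → F N ≈ - F M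
    swap-rows {i} {j} {M} {N} i≢j Nᵢ Nⱼ N≈M = +-inverseˡ-unique (F N) (F M) (begin
      F N + F M                        ≈⟨ +-cong (cong N≈) (cong M≈) ⟩
      F (W v u) + F (W u v)            ≈⟨ +-comm _ _ ⟩
      F (W u v) + F (W v u)            ≈⟨ +-cong W-us W-vs ⟨
      F (W u s) + F (W v s)            ≈⟨ split-i ⟨
      F (W s s)                        ≈⟨ W-same s ⟩
      0#                               ∎)
      where
      u v s : Vector Carrier p
      u = M i
      v = M j
      s k = u k + v k

      W : Vector Carrier p → Vector Carrier p → Matrix n p
      W x y = setRow j y (setRow i x M)

      Wᵢ : ∀ {x y} k → W x y i k ≈ x k
      Wᵢ k = trans (setRow-off j i i≢j k) (setRow-at i k)

      Wⱼ : ∀ {x y} k → W x y j k ≈ y k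
      Wⱼ k = setRow-at j k

      W-off : ∀ {x y} l → l ≢ i → l ≢ j → ∀ k → W x y l k ≈ M l k
      W-off l l≢i l≢j k = trans (setRow-off j l l≢j k) (setRow-off i l l≢i k)

      W-unique : ∀ {x y} {K : Matrix n p} → (∀ k → K i k ≈ x k) → (∀ k → K j k ≈ y k) →
                 (∀ l → l ≢ i → l ≢ j → ∀ k → K l k ≈ M l k) → K ≈ᴹ W x y
      W-unique Kᵢ Kⱼ K≈M l k with l ≟ i | l ≟ j
      ... | yes ≡.refl | _          = trans (Kᵢ k) (sym (Wᵢ k))
      ... | no _       | yes ≡.refl = trans (Kⱼ k) (sym (Wⱼ k))
      ... | no l≢i     | no l≢j     = trans (K≈M l l≢i l≢j k) (sym (W-off l l≢i l≢j k))

      N≈ : N ≈ᴹ W v u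
      N≈ = W-unique Nᵢ Nⱼ N≈M

      M≈ : M ≈ᴹ W u v
      M≈ = W-unique (λ _ → refl) (λ _ → refl) (λ _ _ _ _ → refl)

      W-same : ∀ x → F (W x x) ≈ 0#
      W-same x = alternating i≢j λ k → trans (Wᵢ k) (sym (Wⱼ k))

      agree-i : ∀ {x x′ y} → AgreeOff i (W x y) (W x′ y)
      agree-i {x} {x′} l l≢i k with l ≟ j
      ... | yes ≡.refl = trans (Wⱼ {x} k) (sym (Wⱼ {x′} k))
      ... | no l≢j     = trans (W-off l l≢i l≢j k) (sym (W-off l l≢i l≢j k))

      agree-j : ∀ {x y y′} → AgreeOff j (W x y) (W x y′)
      agree-j l l≢j k = trans (setRow-off j l l≢j k) (sym (setRow-off j l l≢j k))

      split-i : F (W s s) ≈ F (W u s) + F (W v s)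
      split-i = trans (linear i 1# (agree-i {u} {s}) (agree-i {v} {s}) λ k →
          trans (Wᵢ k) (sym (+-cong (trans (*-identityˡ _) (Wᵢ k)) (Wᵢ k))))
        (+-congʳ (*-identityˡ _))

      split-j : ∀ x → F (W x s) ≈ F (W x u) + F (W x v)
      split-j x = trans (linear j 1# (agree-j {x}) (agree-j {x}) λ k →
          trans (Wⱼ {x} k) (sym (+-cong (trans (*-identityˡ _) (Wⱼ {x} k)) (Wⱼ {x} k))))
        (+-congʳ (*-identityˡ _))

      W-us : F (W u s) ≈ F (W u v)
      W-us = trans (split-j u) (trans (+-congʳ (W-same u)) (+-identityˡ _))

      W-vs : F (W v s) ≈ F (W v u)
      W-vs = trans (split-j v) (trans (+-congˡ (W-same v)) (+-identityʳ _))

  -- Fixing the first row makes inductions on the number of rows possible.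
  tail-alternating : ∀ {n p} {F : Matrix (suc n) p → Carrier} (r : Vector Carrier p) →
                     IsAlternating F → IsAlternating (λ M → F (r ∷ M))
  tail-alternating {F = F} r F-alt = record
    { cong        = λ M≈N → cong λ { zero j → refl ; (suc i) j → M≈N i j }
    ; linear      = λ i a M≈K N≈K Kᵢ → linear (suc i) a (agree M≈K) (agree N≈K) Kᵢ
    ; alternating = λ i≢j eq → alternating (i≢j ∘ suc-injective) eq
    }
    where
    open IsAlternating F-alt
    agree : ∀ {i M N} → AgreeOff i M N → AgreeOff (suc i) (r ∷ M) (r ∷ N)
    agree M≈N zero    _    j = refl
    agree M≈N (suc k) k≢i  j = M≈N k (k≢i ∘ ≡.cong suc) j

  -- Right multiplication acts on each row separately and linearly, so linear relations between rows
  -- and equality of rows survive it.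
  *ᴹ-alternating : ∀ {n p q} {F : Matrix n q → Carrier} (N : Matrix p q) →
                   IsAlternating F → IsAlternating (λ M → F (M *ᴹ N))
  *ᴹ-alternating N F-alt = record
    { cong        = λ M≈M′ → cong (*ᴹ-cong M≈M′ λ _ _ → refl)
    ; linear      = λ i a {M} {M′} {K} M≈K M′≈K Kᵢ → linear i a
        (λ k k≢i j → sum-cong-≋ λ r → *-congʳ (M≈K k k≢i r))
        (λ k k≢i j → sum-cong-≋ λ r → *-congʳ (M′≈K k k≢i r))
        (λ j → trans
          (sum-cong-≋ λ r → trans (*-congʳ (Kᵢ r))
            (trans (distribʳ (N r j) (a * M i r) (M′ i r)) (+-congʳ (*-assoc a (M i r) (N r j)))))
          (sum-linear a (λ r → M i r * N r j) (λ r → M′ i r * N r j)))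
    ; alternating = λ i≢j eq → alternating i≢j λ k → sum-cong-≋ λ r → *-congʳ (eq r)
    }
    where open IsAlternating F-alt

  -- Rows are exchanged one at a time from the top. When row i is reached, the rows above come from
  -- T and those below still from S, so `step` is required for arbitrary common other rows.
  change-rows : ∀ {n p} {F : Matrix n p → Carrier} → (∀ {M N} → M ≈ᴹ N → F M ≈ F N) →
                ∀ {S T : Matrix n p} →
                (∀ i {M N} → AgreeOff i M N → (∀ j → M i j ≈ S i j) → (∀ j → N i j ≈ T i j) → F M ≈ F N) →
                F S ≈ F T
  change-rows {zero}          F-cong step = F-cong λ ()
  change-rows {suc n} {F = F} F-cong {S} {T} step = begin
    F S                    ≈⟨ step zero S≈ (λ _ → refl) (λ _ → refl) ⟩
    F (T zero ∷ tail S)    ≈⟨ change-rows (λ M≈N → F-cong λ { zero j → refl ; (suc i) j → M≈N i j })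
                                (λ i M≈N Mᵢ Nᵢ → step (suc i) (cons M≈N) Mᵢ Nᵢ) ⟩
    F (T zero ∷ tail T)    ≈⟨ F-cong (λ { zero j → refl ; (suc i) j → refl }) ⟩
    F T                    ∎
    where
    S≈ : AgreeOff zero S (T zero ∷ tail S)
    S≈ zero    k≢0 = contradiction ≡.refl k≢0
    S≈ (suc k) _ j = refl
    cons : ∀ {i M N} → AgreeOff i M N → AgreeOff (suc i) (T zero ∷ M) (T zero ∷ N)
    cons M≈N zero    _    j = refl
    cons M≈N (suc k) k≢i  j = M≈N k (k≢i ∘ ≡.cong suc) j

  -- The determinant

  minor : ∀ {n} → Matrix (suc n) (suc n) → Fin (suc n) → Matrix n n
  minor M j i k = M (suc i) (punchIn j k)

  sign : ∀ {n} → Fin n → Carrier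
  sign j = (- 1#) ^ toℕ j

  det-cong : ∀ {n} {M N : Matrix n n} → M ≈ᴹ N → det M ≈ det N
  det-cong {zero}  M≈N = refl
  det-cong {suc n} M≈N = sum-cong-≋ λ j →
    *-cong (*-congˡ {sign j} (M≈N zero j)) (det-cong λ i k → M≈N (suc i) (punchIn j k))

  -- The two orders of deleting a pair of columns give the same minor with opposite signs.
  laplace₂-cancel : ∀ n (a : Vector Carrier (suc (suc n))) (d : (Fin n → Fin (suc (suc n))) → Carrier) →
    (∀ {r r′} → (∀ c → r c ≡ r′ c) → d r ≈ d r′) →
    sum (λ j → sign j * a j * sum (λ k → sign k * a (punchIn j k) * d (punchIn j ∘ punchIn k))) ≈ 0#
  laplace₂-cancel n a d d-cong = begin
    -- Pairs containing column zero cancel: choosing it first or second gives the same product up to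
    -- the extra factor -1 in `sign (suc j)`. The pairs of nonzero columns remain in `deeper`.
    1# * a zero * sum top + sum (λ j → (- 1# * sign j) * a (suc j) *
        (1# * a zero * d (punchIn (suc j) ∘ suc) + T j))
      ≈⟨ +-cong (trans (*-distribˡ-sum _ top) (sum-cong-≋ λ j → sym (cross₂ j)))
                (sum-cong-≋ λ j → trans (distribˡ _ _ (T j)) (+-congʳ (cross j))) ⟩
    sum cross-terms + sum (λ j → - cross-terms j + deeper j)
      ≈⟨ ∑-distrib-+ cross-terms (λ j → - cross-terms j + deeper j) ⟨
    sum (λ j → cross-terms j + (- cross-terms j + deeper j))
      ≈⟨ sum-cong-≋ {x = λ j → cross-terms j + (- cross-terms j + deeper j)} (λ j → trans
           (sym (+-assoc (cross-terms j) (- cross-terms j) (deeper j)))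
           (trans (+-congʳ (-‿inverseʳ (cross-terms j))) (+-identityˡ (deeper j)))) ⟩
    sum deeper
      ≈⟨ rest n a d d-cong ⟩
    0# ∎
    where
    top : Vector Carrier (suc n)
    top k = sign k * a (suc k) * d (suc ∘ punchIn k)
    T : Vector Carrier (suc n)
    T j = sum λ k → (- 1# * sign k) * a (punchIn (suc j) (suc k)) * d (punchIn (suc j) ∘ punchIn (suc k))
    cross-terms : Vector Carrier (suc n)
    cross-terms j = sign j * a (suc j) * (a zero * d (punchIn (suc j) ∘ suc))
    deeper : Vector Carrier (suc n)
    deeper j = (- 1# * sign j) * a (suc j) * T j
    cross₂ : ∀ j → cross-terms j ≈ 1# * a zero * top j
    cross₂ j = solve 4 (λ s x y z → s :* x :* (y :* z) := con 1 :* y :* (s :* x :* z))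
      refl (sign j) (a (suc j)) (a zero) (d (suc ∘ punchIn j))
    cross : ∀ j → (- 1# * sign j) * a (suc j) * (1# * a zero * d (punchIn (suc j) ∘ suc)) ≈ - cross-terms j
    cross j = trans (solve 5 (λ m s x y z → m :* s :* x :* (con 1 :* y :* z) := m :* (s :* x :* (y :* z)))
      refl (- 1#) (sign j) (a (suc j)) (a zero) (d (punchIn (suc j) ∘ suc))) (-1*x≈-x _)
    -- A pair of nonzero columns carries two extra factors -1, whose product is 1. What is left is
    -- the claim for the tail of a, where `lift` puts the untouched column zero back among the
    -- surviving columns. With only two columns in all there is no such pair.
    rest : ∀ n (a : Vector Carrier (suc (suc n))) (d : (Fin n → Fin (suc (suc n))) → Carrier) →
      (∀ {r r′} → (∀ c → r c ≡ r′ c) → d r ≈ d r′) →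
      sum (λ j → (- 1# * sign j) * a (suc j) * sum (λ k →
        (- 1# * sign k) * a (punchIn (suc j) (suc k)) * d (punchIn (suc j) ∘ punchIn (suc k)))) ≈ 0#
    rest zero    a d d-cong = trans (+-identityʳ _) (zeroʳ _)
    rest (suc n) a d d-cong = trans (sum-cong-≋ λ j → begin
        (- 1# * sign j) * a (suc j) * sum (λ k → (- 1# * sign k) * a (suc (punchIn j k)) *
            d (punchIn (suc j) ∘ punchIn (suc k)))
          ≈⟨ *-congˡ (sum-cong-≋ λ k → trans
               (*-cong (*-assoc (- 1#) (sign k) (a (suc (punchIn j k)))) (d-cong (lift-punchIn j k)))
               (*-assoc (- 1#) (sign k * a (suc (punchIn j k))) (d (lift (punchIn j ∘ punchIn k))))) ⟩
        (- 1# * sign j) * a (suc j) * sum (λ k → - 1# * (sign k * a (suc (punchIn j k)) *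
            d (lift (punchIn j ∘ punchIn k))))
          ≈⟨ *-congˡ (*-distribˡ-sum (- 1#) λ k →
               sign k * a (suc (punchIn j k)) * d (lift (punchIn j ∘ punchIn k))) ⟨
        (- 1# * sign j) * a (suc j) * (- 1# * Σ′ j)
          ≈⟨ solve 4 (λ m s x y → m :* s :* x :* (m :* y) := (m :* m) :* (s :* x :* y))
               refl (- 1#) (sign j) (a (suc j)) (Σ′ j) ⟩
        (- 1# * - 1#) * (sign j * a (suc j) * Σ′ j)
          ≈⟨ *-congʳ (trans (-1*x≈-x (- 1#)) (-‿involutive 1#)) ⟩
        1# * (sign j * a (suc j) * Σ′ j)
          ≈⟨ *-identityˡ _ ⟩
        sign j * a (suc j) * Σ′ j ∎)
      (laplace₂-cancel n (tail a) (d ∘ lift) λ r≡r′ → d-cong λ { zero → ≡.refl ; (suc c) → ≡.cong suc (r≡r′ c) })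
      where
      lift : (Fin n → Fin (suc (suc n))) → Fin (suc n) → Fin (suc (suc (suc n)))
      lift r zero    = zero
      lift r (suc c) = suc (r c)
      lift-punchIn : ∀ (j : Fin (suc (suc n))) (k : Fin (suc n)) c →
                     punchIn (suc j) (punchIn (suc k) c) ≡ lift (punchIn j ∘ punchIn k) c
      lift-punchIn j k zero    = ≡.refl
      lift-punchIn j k (suc c) = ≡.refl
      Σ′ : Vector Carrier (suc (suc n))
      Σ′ j = sum λ k → sign k * a (suc (punchIn j k)) * d (lift (punchIn j ∘ punchIn k))

  det-linear : ∀ {n} i a {M N K : Matrix n n} → AgreeOff i M K → AgreeOff i N K →
               (∀ j → K i j ≈ a * M i j + N i j) → det K ≈ a * det M + det N
  det-linear zero a {M} {N} {K} M≈K N≈K K₀ = trans (sum-cong-≋ λ j → begin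
      sign j * K zero j * det (minor K j)
        ≈⟨ *-congʳ (*-congˡ (K₀ j)) ⟩
      sign j * (a * M zero j + N zero j) * det (minor K j)
        ≈⟨ solve 5 (λ s a x y d → s :* (a :* x :+ y) :* d := a :* (s :* x :* d) :+ s :* y :* d)
             refl (sign j) a (M zero j) (N zero j) (det (minor K j)) ⟩
      a * (sign j * M zero j * det (minor K j)) + sign j * N zero j * det (minor K j)
        ≈⟨ +-cong (*-congˡ (*-congˡ (det-cong λ i k → sym (M≈K (suc i) (λ ()) (punchIn j k)))))
                  (*-congˡ (det-cong λ i k → sym (N≈K (suc i) (λ ()) (punchIn j k)))) ⟩
      a * (sign j * M zero j * det (minor M j)) + sign j * N zero j * det (minor N j) ∎)
    (sum-linear a (λ j → sign j * M zero j * det (minor M j)) (λ j → sign j * N zero j * det (minor N j)))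
  det-linear (suc i) a {M} {N} {K} M≈K N≈K Kᵢ = trans (sum-cong-≋ λ j → begin
      sign j * K zero j * det (minor K j)
        ≈⟨ *-congˡ (det-linear i a (λ k k≢i l → M≈K (suc k) (k≢i ∘ suc-injective) (punchIn j l))
                                   (λ k k≢i l → N≈K (suc k) (k≢i ∘ suc-injective) (punchIn j l))
                                   (λ l → Kᵢ (punchIn j l))) ⟩
      sign j * K zero j * (a * det (minor M j) + det (minor N j))
        ≈⟨ solve 5 (λ s x a d e → s :* x :* (a :* d :+ e) := a :* (s :* x :* d) :+ s :* x :* e)
             refl (sign j) (K zero j) a (det (minor M j)) (det (minor N j)) ⟩
      a * (sign j * K zero j * det (minor M j)) + sign j * K zero j * det (minor N j)
        ≈⟨ +-cong (*-congˡ (*-congʳ (*-congˡ (sym (M≈K zero (λ ()) j)))))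
                  (*-congʳ (*-congˡ (sym (N≈K zero (λ ()) j)))) ⟩
      a * (sign j * M zero j * det (minor M j)) + sign j * N zero j * det (minor N j) ∎)
    (sum-linear a (λ j → sign j * M zero j * det (minor M j)) (λ j → sign j * N zero j * det (minor N j)))

  -- Expanding along the first two rows gives a sum over ordered pairs of columns. As the rows are
  -- equal, both factors can be read from row zero, which is the sum that `laplace₂-cancel`
  -- annihilates.
  det-equal-rows₀₁ : ∀ {n} (M : Matrix (suc (suc n)) (suc (suc n))) →
                     (∀ k → M zero k ≈ M (suc zero) k) → det M ≈ 0#
  det-equal-rows₀₁ {n} M eq = trans
    (sum-cong-≋ λ j → *-congˡ {sign j * M zero j} (sum-cong-≋ λ k →
      *-congʳ {det (minor (minor M j) k)} (*-congˡ {sign k} (sym (eq (punchIn j k))))))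
    (laplace₂-cancel n (M zero) (λ r → det λ i c → M (suc (suc i)) (r c))
      λ r≡r′ → det-cong λ i c → reflexive (≡.cong (M (suc (suc i))) (r≡r′ c)))

  -- Interchanging the second row with the one equal to the first leaves row zero alone, so it
  -- happens inside the minors, which alternate by hypothesis. It brings the equal rows together at
  -- the top at the cost of a sign.
  det-equal-rows₀ : ∀ {n} → IsAlternating (det {n}) → ∀ (M : Matrix (suc n) (suc n)) j →
                    (∀ k → M zero k ≈ M (suc j) k) → det M ≈ 0#
  det-equal-rows₀ {suc n} _       M zero    eq = det-equal-rows₀₁ M eq
  det-equal-rows₀ {suc n} det-alt M (suc j) eq = begin
    det M      ≈⟨ -‿involutive _ ⟨
    - - det M  ≈⟨ -‿cong det-N ⟨
    - det N    ≈⟨ -‿cong (det-equal-rows₀₁ N eq) ⟩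
    - 0#       ≈⟨ -0#≈0# ⟩
    0#         ∎
    where
    N : Matrix (suc (suc n)) (suc (suc n))
    N = setRow (suc zero) (M (suc (suc j))) (setRow (suc (suc j)) (M (suc zero)) M)
    open Alternating det-alt
    minors : ∀ l → det (minor N l) ≈ - det (minor M l)
    minors l = swap-rows {zero} {suc j} {minor M l} {minor N l} (λ ()) (λ k → refl)
      (λ k → setRow-at (suc (suc j)) {M (suc zero)} {M} (punchIn l k))
      λ { zero 0≢0 _ k → contradiction ≡.refl 0≢0
        ; (suc r) _ r≢ k → setRow-off (suc (suc j)) {M (suc zero)} {M} (suc (suc r)) (r≢ ∘ suc-injective)
            (punchIn l k) }
    det-N : det N ≈ - det M
    det-N = begin
      sum (λ l → sign l * M zero l * det (minor N l))
        ≈⟨ sum-cong-≋ (λ l → trans (*-congˡ (trans (minors l) (sym (-1*x≈-x _))))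
             (solve 3 (λ x m y → x :* (m :* y) := m :* (x :* y)) refl (sign l * M zero l) (- 1#) (det (minor M l)))) ⟩
      sum (λ l → - 1# * (sign l * M zero l * det (minor M l)))
        ≈⟨ *-distribˡ-sum (- 1#) (λ l → sign l * M zero l * det (minor M l)) ⟨
      - 1# * det M ≈⟨ -1*x≈-x _ ⟩
      - det M ∎

  det-isAlternating : ∀ {n} → IsAlternating (det {n})
  det-isAlternating {zero}  = record { cong = det-cong ; linear = λ () ; alternating = λ { {()} } }
  det-isAlternating {suc n} = record { cong = det-cong ; linear = det-linear ; alternating = alt }
    where
    det-alt : IsAlternating (det {n})
    det-alt = det-isAlternating
    alt : ∀ {i j} {M : Matrix (suc n) (suc n)} → i ≢ j → (∀ k → M i k ≈ M j k) → det M ≈ 0#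
    alt {zero}  {zero}      i≢j eq = contradiction ≡.refl i≢j
    alt {zero}  {suc j} {M} i≢j eq = det-equal-rows₀ det-alt M j eq
    alt {suc i} {zero}  {M} i≢j eq = det-equal-rows₀ det-alt M i (sym ∘ eq)
    alt {suc i} {suc j} {M} i≢j eq = sum-zero λ l → trans
      (*-congˡ {sign l * M zero l}
        (IsAlternating.alternating det-alt {M = minor M l} (i≢j ∘ ≡.cong suc) λ k → eq (punchIn l k)))
      (zeroʳ (sign l * M zero l))

  -- One swap passes row `suc j` over row zero. The rest of the move keeps row zero fixed, so it is
  -- the same statement for the function of the remaining rows.
  move-row-to-front : ∀ {n p} {F : Matrix (suc n) p → Carrier} → IsAlternating F →
                      ∀ (V : Matrix (suc n) p) j → F (V j ∷ V ∘ punchIn j) ≈ sign j * F V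
  move-row-to-front {F = F} F-alt V zero = trans
    (cong λ { zero k → refl ; (suc i) k → refl }) (sym (*-identityˡ (F V)))
    where open IsAlternating F-alt
  move-row-to-front {suc n} {F = F} F-alt V (suc j) = begin
    F (V (suc j) ∷ V ∘ punchIn (suc j))
      ≈⟨ swap-rows {zero} {suc zero} (λ ()) (λ k → refl) (λ k → refl)
           (λ { zero 0≢0 _ k → contradiction ≡.refl 0≢0
              ; (suc zero) _ 1≢1 k → contradiction ≡.refl 1≢1
              ; (suc (suc l)) _ _ k → refl }) ⟩
    - F (V zero ∷ (tail V j ∷ tail V ∘ punchIn j))
      ≈⟨ -‿cong (move-row-to-front (tail-alternating (V zero) F-alt) (tail V) j) ⟩
    - (sign j * F (V zero ∷ tail V))
      ≈⟨ -‿cong (*-congˡ (cong λ { zero k → refl ; (suc i) k → refl })) ⟩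
    - (sign j * F V)
      ≈⟨ -1*x≈-x _ ⟨
    - 1# * (sign j * F V)
      ≈⟨ *-assoc (- 1#) (sign j) (F V) ⟨
    sign (suc j) * F V ∎
    where open Alternating F-alt

  -- Row zero is a combination of the unit rows `I j`. With `I j` on top, column j below it can be
  -- cleared, after which F depends on the rest through an alternating function of the minor, to
  -- which the induction applies. Moving `I j` back to its place yields the sign, and the Laplace
  -- expansion appears.
  alternating-unique : ∀ {n} {F : Matrix n n → Carrier} → IsAlternating F →
                       ∀ M → F M ≈ det M * F I
  alternating-unique {zero}  {F} F-alt M = trans (IsAlternating.cong F-alt λ ()) (sym (*-identityˡ (F I)))
  alternating-unique {suc n} {F} F-alt M = begin
    F M
      ≈⟨ row-sum {M = M} zero (M zero) (λ j → I j ∷ tail M) (λ j → off j) (λ k → sym (*ᴹ-identityʳ M zero k)) ⟩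
    sum (λ j → M zero j * F (I j ∷ tail M))
      ≈⟨ sum-cong-≋ (λ j → *-congˡ {M zero j} (expand j)) ⟩
    sum (λ j → M zero j * (det (minor M j) * (sign j * F I)))
      ≈⟨ sum-cong-≋ (λ j → solve 4 (λ x d s y → x :* (d :* (s :* y)) := s :* x :* d :* y)
           refl (M zero j) (det (minor M j)) (sign j) (F I)) ⟩
    sum (λ j → sign j * M zero j * det (minor M j) * F I)
      ≈⟨ *-distribʳ-sum (F I) (λ j → sign j * M zero j * det (minor M j)) ⟨
    det M * F I ∎
    where
    open Alternating F-alt
    off : ∀ j → AgreeOff zero (I j ∷ tail M) M
    off j zero    0≢0 = contradiction ≡.refl 0≢0
    off j (suc k) _ l = refl
    -- `E j` is the identity matrix without row j, so `minor M j *ᴹ E j` is the minor with a zero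
    -- column inserted at position j.
    E : Fin (suc n) → Matrix n (suc n)
    E j k = I (punchIn j k)
    -- Subtracting multiples of the first row I j clears column j below it.
    clear : ∀ j → F (I j ∷ tail M) ≈ F (I j ∷ minor M j *ᴹ E j)
    clear j = change-rows {F = λ T → F (I j ∷ T)} (λ T≈T′ → cong λ { zero k → refl ; (suc i) k → T≈T′ i k })
      λ i {S} {T} S≈T Sᵢ Tᵢ → add-row {suc i} {zero} {I j ∷ S} {I j ∷ T} (M (suc i) j) (λ ())
        (λ { zero _ k → refl ; (suc l) l≢i k → sym (S≈T l (l≢i ∘ ≡.cong suc) k) })
        (λ k → trans (Sᵢ k) (trans (sym (*ᴹ-identityʳ M (suc i) k))
          (trans (sum-remove {i = j} (λ r → M (suc i) r * I r k)) (+-congˡ (sym (Tᵢ k))))))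
    expand : ∀ j → F (I j ∷ tail M) ≈ det (minor M j) * (sign j * F I)
    expand j = begin
      F (I j ∷ tail M)
        ≈⟨ clear j ⟩
      F (I j ∷ minor M j *ᴹ E j)
        ≈⟨ alternating-unique (*ᴹ-alternating (E j) (tail-alternating (I j) F-alt)) (minor M j) ⟩
      det (minor M j) * F (I j ∷ I *ᴹ E j)
        ≈⟨ *-congˡ (cong λ { zero k → refl ; (suc i) k → *ᴹ-identityˡ (E j) i k }) ⟩
      det (minor M j) * F (I j ∷ E j)
        ≈⟨ *-congˡ (move-row-to-front F-alt I j) ⟩
      det (minor M j) * (sign j * F I) ∎

  det-*ᴹ : ∀ {n} (M N : Matrix n n) → det (M *ᴹ N) ≈ det M * det N
  det-*ᴹ M N = trans (alternating-unique (*ᴹ-alternating N det-isAlternating) M)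
    (*-congˡ (det-cong (*ᴹ-identityˡ N)))

  -- Mutual induction: in the expansion for `first-column` every minor but the first keeps a zero
  -- column, and `zero-column` is the case in which the corner entry vanishes too.
  zero-column : ∀ {n} (M : Matrix (suc n) (suc n)) → (∀ i → M i zero ≈ 0#) → det M ≈ 0#
  first-column : ∀ {n} (M : Matrix (suc n) (suc n)) → (∀ i → M (suc i) zero ≈ 0#) →
                 det M ≈ M zero zero * det (minor M zero)

  zero-column M M₀≈0 = trans (first-column M (M₀≈0 ∘ suc))
    (trans (*-congʳ {det (minor M zero)} (M₀≈0 zero)) (zeroˡ _))

  first-column {zero}  M M₀≈0 = trans (+-identityʳ _) (*-congʳ {1#} (*-identityˡ (M zero zero)))
  first-column {suc n} M M₀≈0 = trans
    (+-cong (*-congʳ {det (minor M zero)} (*-identityˡ (M zero zero)))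
      (sum-zero λ j → trans (*-congˡ {sign (suc j) * M zero (suc j)} (zero-column (minor M (suc j)) M₀≈0))
        (zeroʳ (sign (suc j) * M zero (suc j)))))
    (+-identityʳ _)

  det-I : ∀ n → det (I {n}) ≈ 1#
  det-I zero    = refl
  det-I (suc n) = trans (first-column {n} I λ _ → refl) (trans (*-identityˡ _) (det-I n))

  unit-det⇒invertible : ∀ {n} (M : Matrix n n) u → det M * u ≈ 1# → Invertible M
  unit-det⇒invertible {n} M u det-M*u≈1 = N , left , right M u det-M*u≈1
    where
    -- The cofactor is written as a determinant with a unit row instead of a signed minor, so that
    -- no signs occur and `row-sum` applies directly.
    adjugate : ∀ (M : Matrix n n) → Matrix n n
    adjugate M j k = det (setRow k (I j) M)

    *-adjugate : ∀ (M : Matrix n n) → M *ᴹ adjugate M ≈ᴹ det M ·I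
    *-adjugate M i k = trans (sym expand) value
      where
      open Alternating (det-isAlternating {n})
      -- Row k is replaced by row i of M. The determinant is then det M if i = k, and has two equal
      -- rows otherwise.
      expand : det (setRow k (M i) M) ≈ sum (λ j → M i j * adjugate M j k)
      expand = row-sum k (M i) (λ j → setRow k (I j) M)
        (λ j l l≢k r → trans (setRow-off k l l≢k r) (sym (setRow-off k l l≢k r)))
        (λ r → trans (setRow-at k r) (trans (sym (*ᴹ-identityʳ M i r))
          (sum-cong-≋ λ j → *-congˡ {M i j} (sym (setRow-at k {I j} {M} r)))))
      value : det (setRow k (M i) M) ≈ (det M ·I) i k
      value with i ≟ k
      ... | yes ≡.refl = cong (λ l r → same l r)
        where
        same : ∀ l r → setRow i (M i) M l r ≈ M l r
        same l r with l ≟ i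
        ... | yes ≡.refl = setRow-at i r
        ... | no l≢i     = setRow-off i l l≢i r
      ... | no i≢k = alternating i≢k λ r → trans (setRow-off k i i≢k r) (sym (setRow-at k r))

    right-inverse : Matrix n n → Carrier → Matrix n n
    right-inverse M u j k = adjugate M j k * u

    right : ∀ M u → det M * u ≈ 1# → M *ᴹ right-inverse M u ≈ᴹ I
    right M u eq i k = begin
      sum (λ j → M i j * (adjugate M j k * u))  ≈⟨ sum-cong-≋ (λ j → *-assoc (M i j) (adjugate M j k) u) ⟨
      sum (λ j → M i j * adjugate M j k * u)    ≈⟨ *-distribʳ-sum u (λ j → M i j * adjugate M j k) ⟨
      (M *ᴹ adjugate M) i k * u                 ≈⟨ *-congʳ (*-adjugate M i k) ⟩
      (det M ·I) i k * u                        ≈⟨ scale ⟩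
      I i k                                     ∎
      where
      scale : (det M ·I) i k * u ≈ I i k
      scale with does (i ≟ k)
      ... | true  = eq
      ... | false = zeroˡ u

    N : Matrix n n
    N = right-inverse M u

    -- The right inverse N has a right inverse K, since its determinant is a unit; then K ≈ M N K ≈ M.
    K : Matrix n n
    K = right-inverse N (det M)

    N*K : N *ᴹ K ≈ᴹ I
    N*K = right N (det M) (begin
      det N * det M    ≈⟨ *-comm _ _ ⟩
      det M * det N    ≈⟨ det-*ᴹ M N ⟨
      det (M *ᴹ N)     ≈⟨ det-cong (right M u det-M*u≈1) ⟩
      det (I {n})      ≈⟨ det-I n ⟩
      1#               ∎)

    K≈M : K ≈ᴹ M
    K≈M i j = begin
      K i j                    ≈⟨ *ᴹ-identityˡ K i j ⟨
      (I *ᴹ K) i j             ≈⟨ *ᴹ-cong {N = K} (right M u det-M*u≈1) (λ _ _ → refl) i j ⟨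
      ((M *ᴹ N) *ᴹ K) i j      ≈⟨ *ᴹ-assoc M N K i j ⟩
      (M *ᴹ (N *ᴹ K)) i j      ≈⟨ *ᴹ-cong {M = M} {N = N *ᴹ K} (λ _ _ → refl) N*K i j ⟩
      (M *ᴹ I) i j             ≈⟨ *ᴹ-identityʳ M i j ⟩
      M i j                    ∎

    left : N *ᴹ M ≈ᴹ I
    left i j = begin
      (N *ᴹ M) i j  ≈⟨ *ᴹ-cong {M = N} {N = K} {N′ = M} (λ _ _ → refl) K≈M i j ⟨
      (N *ᴹ K) i j  ≈⟨ N*K i j ⟩
      I i j         ∎

  -- Block matrices

  block : ∀ {m n p q} → Matrix m p → Matrix m q → Matrix n p → Matrix n q →
          Matrix (m ℕ.+ n) (p ℕ.+ q)
  block A B C D = (λ i → A i ++ B i) ++ (λ i → C i ++ D i)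

  module _ {m n p q} (A : Matrix m p) (B : Matrix m q) (C : Matrix n p) (D : Matrix n q) where

    block-₁₁ : ∀ i j → block A B C D (i ↑ˡ n) (j ↑ˡ q) ≡ A i j
    block-₁₁ i j rewrite splitAt-↑ˡ m i n | splitAt-↑ˡ p j q = ≡.refl

    block-₁₂ : ∀ i j → block A B C D (i ↑ˡ n) (p ↑ʳ j) ≡ B i j
    block-₁₂ i j rewrite splitAt-↑ˡ m i n | splitAt-↑ʳ p q j = ≡.refl

    block-₂₁ : ∀ i j → block A B C D (m ↑ʳ i) (j ↑ˡ q) ≡ C i j
    block-₂₁ i j rewrite splitAt-↑ʳ m n i | splitAt-↑ˡ p j q = ≡.refl

    block-₂₂ : ∀ i j → block A B C D (m ↑ʳ i) (p ↑ʳ j) ≡ D i j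
    block-₂₂ i j rewrite splitAt-↑ʳ m n i | splitAt-↑ʳ p q j = ≡.refl

  ↑-elim : ∀ {a} m {n} (P : Fin (m ℕ.+ n) → Set a) →
           (∀ i → P (i ↑ˡ n)) → (∀ j → P (m ↑ʳ j)) → ∀ k → P k
  ↑-elim m {n} P l r k with splitAt m k | join-splitAt m n k
  ... | inj₁ i | ≡.refl = l i
  ... | inj₂ j | ≡.refl = r j

  ≈ᴹ-block : ∀ {m n p q} {M : Matrix (m ℕ.+ n) (p ℕ.+ q)}
             {A : Matrix m p} {B : Matrix m q} {C : Matrix n p} {D : Matrix n q} →
             (∀ i j → M (i ↑ˡ n) (j ↑ˡ q) ≈ A i j) → (∀ i j → M (i ↑ˡ n) (p ↑ʳ j) ≈ B i j) →
             (∀ i j → M (m ↑ʳ i) (j ↑ˡ q) ≈ C i j) → (∀ i j → M (m ↑ʳ i) (p ↑ʳ j) ≈ D i j) →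
             M ≈ᴹ block A B C D
  ≈ᴹ-block {m} {n} {p} {q} {M} {A} {B} {C} {D} M₁₁ M₁₂ M₂₁ M₂₂ = ↑-elim m _
    (λ i → ↑-elim p _ (λ j → trans (M₁₁ i j) (reflexive (≡.sym (block-₁₁ A B C D i j))))
                      (λ j → trans (M₁₂ i j) (reflexive (≡.sym (block-₁₂ A B C D i j)))))
    (λ i → ↑-elim p _ (λ j → trans (M₂₁ i j) (reflexive (≡.sym (block-₂₁ A B C D i j))))
                      (λ j → trans (M₂₂ i j) (reflexive (≡.sym (block-₂₂ A B C D i j)))))

  block-cong : ∀ {m n p q} {A A′ : Matrix m p} {B B′ : Matrix m q} {C C′ : Matrix n p} {D D′ : Matrix n q} →
               A ≈ᴹ A′ → B ≈ᴹ B′ → C ≈ᴹ C′ → D ≈ᴹ D′ → block A B C D ≈ᴹ block A′ B′ C′ D′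
  block-cong {A = A} {B = B} {C = C} {D = D} A≈ B≈ C≈ D≈ = ≈ᴹ-block
    (λ i j → trans (reflexive (block-₁₁ A B C D i j)) (A≈ i j))
    (λ i j → trans (reflexive (block-₁₂ A B C D i j)) (B≈ i j))
    (λ i j → trans (reflexive (block-₂₁ A B C D i j)) (C≈ i j))
    (λ i j → trans (reflexive (block-₂₂ A B C D i j)) (D≈ i j))

  block-*ᴹ : ∀ {m n p q r s}
             (A : Matrix m p) (B : Matrix m q) (C : Matrix n p) (D : Matrix n q)
             (A′ : Matrix p r) (B′ : Matrix p s) (C′ : Matrix q r) (D′ : Matrix q s) →
             block A B C D *ᴹ block A′ B′ C′ D′ ≈ᴹ
             block (A *ᴹ A′ +ᴹ B *ᴹ C′) (A *ᴹ B′ +ᴹ B *ᴹ D′)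
                   (C *ᴹ A′ +ᴹ D *ᴹ C′) (C *ᴹ B′ +ᴹ D *ᴹ D′)
  block-*ᴹ {p = p} A B C D A′ B′ C′ D′ = ≈ᴹ-block
    (λ i j → entry (block-₁₁ A B C D i) (block-₁₂ A B C D i)
      (λ r → block-₁₁ A′ B′ C′ D′ r j) (λ r → block-₂₁ A′ B′ C′ D′ r j))
    (λ i j → entry (block-₁₁ A B C D i) (block-₁₂ A B C D i)
      (λ r → block-₁₂ A′ B′ C′ D′ r j) (λ r → block-₂₂ A′ B′ C′ D′ r j))
    (λ i j → entry (block-₂₁ A B C D i) (block-₂₂ A B C D i)
      (λ r → block-₁₁ A′ B′ C′ D′ r j) (λ r → block-₂₁ A′ B′ C′ D′ r j))
    (λ i j → entry (block-₂₁ A B C D i) (block-₂₂ A B C D i)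
      (λ r → block-₁₂ A′ B′ C′ D′ r j) (λ r → block-₂₂ A′ B′ C′ D′ r j))
    where
    entry : ∀ {q} {x y : Vector Carrier (p ℕ.+ q)} {x₁ y₁ : Vector Carrier p} {x₂ y₂ : Vector Carrier q} →
            (∀ r → x (r ↑ˡ q) ≡ x₁ r) → (∀ r → x (p ↑ʳ r) ≡ x₂ r) →
            (∀ r → y (r ↑ˡ q) ≡ y₁ r) → (∀ r → y (p ↑ʳ r) ≡ y₂ r) →
            sum (λ r → x r * y r) ≈ sum (λ r → x₁ r * y₁ r) + sum (λ r → x₂ r * y₂ r)
    entry {x = x} {y} x₁ x₂ y₁ y₂ = trans (sum-++ p (λ r → x r * y r))
      (+-cong (sum-cong-≋ λ r → *-cong (reflexive (x₁ r)) (reflexive (y₁ r)))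
              (sum-cong-≋ λ r → *-cong (reflexive (x₂ r)) (reflexive (y₂ r))))

  block-suc : ∀ {m n p q} (A : Matrix (suc m) (suc p)) (B : Matrix (suc m) q)
              (C : Matrix n (suc p)) (D : Matrix n q) j →
              (λ i k → block A B C D (suc i) (punchIn (j ↑ˡ q) k)) ≈ᴹ
              block (λ i k → A (suc i) (punchIn j k)) (tail B) (λ i k → C i (punchIn j k)) D
  block-suc {m} {n} {p} {q} A B C D j = ≈ᴹ-block
    (λ i k → reflexive (≡.trans (≡.cong (block A B C D (suc (i ↑ˡ n))) (punchIn-↑ˡ j k))
      (block-₁₁ A B C D (suc i) (punchIn j k))))
    (λ i k → reflexive (≡.trans (≡.cong (block A B C D (suc (i ↑ˡ n))) (punchIn-↑ʳ j k))
      (block-₁₂ A B C D (suc i) k)))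
    (λ i k → reflexive (≡.trans (≡.cong (block A B C D (suc (m ↑ʳ i))) (punchIn-↑ˡ j k))
      (block-₂₁ A B C D i (punchIn j k))))
    (λ i k → reflexive (≡.trans (≡.cong (block A B C D (suc (m ↑ʳ i))) (punchIn-↑ʳ j k))
      (block-₂₂ A B C D i k)))
    where
    punchIn-↑ˡ : ∀ {p} (j : Fin (suc p)) k → punchIn (j ↑ˡ q) (k ↑ˡ q) ≡ punchIn j k ↑ˡ q
    punchIn-↑ˡ zero    k       = ≡.refl
    punchIn-↑ˡ (suc j) zero    = ≡.refl
    punchIn-↑ˡ (suc j) (suc k) = ≡.cong suc (punchIn-↑ˡ j k)
    punchIn-↑ʳ : ∀ {p} (j : Fin (suc p)) k → punchIn (j ↑ˡ q) (p ↑ʳ k) ≡ suc p ↑ʳ k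
    punchIn-↑ʳ {zero}  zero    k = ≡.refl
    punchIn-↑ʳ {suc p} zero    k = ≡.refl
    punchIn-↑ʳ {suc p} (suc j) k = ≡.cong suc (punchIn-↑ʳ j k)

  det-block-lower : ∀ {m n} (A : Matrix m m) (C : Matrix n m) (D : Matrix n n) →
                    det (block A 0ᴹ C D) ≈ det A * det D
  det-block-lower {zero}      A C D = sym (*-identityˡ (det D))
  det-block-lower {suc m} {n} A C D = begin
    det M
      ≈⟨ sum-++ (suc m) (λ j → sign j * M zero j * det (minor M j)) ⟩
    sum (λ j → sign (j ↑ˡ n) * M zero (j ↑ˡ n) * det (minor M (j ↑ˡ n))) +
    sum (λ j → sign (suc m ↑ʳ j) * M zero (suc m ↑ʳ j) * det (minor M (suc m ↑ʳ j)))
      ≈⟨ +-cong (sum-cong-≋ left) (sum-zero right) ⟩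
    sum (λ j → sign j * A zero j * det (minor A j) * det D) + 0#
      ≈⟨ +-identityʳ _ ⟩
    sum (λ j → sign j * A zero j * det (minor A j) * det D)
      ≈⟨ *-distribʳ-sum (det D) (λ j → sign j * A zero j * det (minor A j)) ⟨
    det A * det D ∎
    where
    M : Matrix (suc m ℕ.+ n) (suc m ℕ.+ n)
    M = block A 0ᴹ C D
    left : ∀ j → sign (j ↑ˡ n) * M zero (j ↑ˡ n) * det (minor M (j ↑ˡ n)) ≈
                 sign j * A zero j * det (minor A j) * det D
    left j = begin
      sign (j ↑ˡ n) * M zero (j ↑ˡ n) * det (minor M (j ↑ˡ n))
        ≈⟨ *-cong (*-cong (reflexive (≡.cong ((- 1#) ^_) (toℕ-↑ˡ j n))) (reflexive (block-₁₁ A 0ᴹ C D zero j)))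
             (trans (det-cong (block-suc A 0ᴹ C D j)) (det-block-lower (minor A j) (λ i k → C i (punchIn j k)) D)) ⟩
      sign j * A zero j * (det (minor A j) * det D)
        ≈⟨ *-assoc _ _ _ ⟨
      sign j * A zero j * det (minor A j) * det D ∎
    right : ∀ j → sign (suc m ↑ʳ j) * M zero (suc m ↑ʳ j) * det (minor M (suc m ↑ʳ j)) ≈ 0#
    right j = trans (*-congʳ {det (minor M (suc m ↑ʳ j))}
        (trans (*-congˡ {sign (suc m ↑ʳ j)} (reflexive (block-₁₂ A 0ᴹ C D zero j))) (zeroʳ _)))
      (zeroˡ _)

  -- Here the first row may be nonzero in the right-hand block, so the reduction uses the first
  -- column, where only the corner survives.
  det-block-unitriangular : ∀ {m n} (B : Matrix m n) → det (block I B 0ᴹ I) ≈ 1#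
  det-block-unitriangular {zero}  {n} B = det-I n
  det-block-unitriangular {suc m} {n} B = begin
    det (block I B 0ᴹ I)
      ≈⟨ first-column (block I B 0ᴹ I) (↑-elim m (λ i → block I B 0ᴹ I (suc i) zero ≈ 0#)
           (λ i → reflexive (block-₁₁ I B 0ᴹ I (suc i) zero))
           (λ i → reflexive (block-₂₁ I B 0ᴹ I i (zero {m})))) ⟩
    1# * det (minor (block I B 0ᴹ I) zero)
      ≈⟨ *-identityˡ _ ⟩
    det (minor (block I B 0ᴹ I) zero)
      ≈⟨ det-cong (block-suc I B 0ᴹ I zero) ⟩
    det (block I (tail B) 0ᴹ I)
      ≈⟨ det-block-unitriangular (tail B) ⟩
    1# ∎

  module _ {m n} (A : Matrix m m) (B : Matrix m n) (C : Matrix n m) (D : Matrix n n) where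

    -- With S the Schur complement, the matrix factors as (I, BD⁻; 0, I) times (S, 0; C, D). The
    -- upper right block of the product is BD⁻D, so `D⁻` has to cancel D from the left.
    schur-lowerRight : ∀ (D⁻ : Matrix n n) → D⁻ *ᴹ D ≈ᴹ I →
                       det (block A B C D) ≈ det D * det (A -ᴹ B *ᴹ D⁻ *ᴹ C)
    schur-lowerRight D⁻ D⁻D≈I = begin
      det (block A B C D)
        ≈⟨ det-cong (λ i j → trans (block-*ᴹ I (B *ᴹ D⁻) 0ᴹ I S 0ᴹ C D i j) (block-cong e₁₁ e₁₂ e₂₁ e₂₂ i j)) ⟨
      det (block I (B *ᴹ D⁻) 0ᴹ I *ᴹ block S 0ᴹ C D)
        ≈⟨ det-*ᴹ (block I (B *ᴹ D⁻) 0ᴹ I) (block S 0ᴹ C D) ⟩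
      det (block I (B *ᴹ D⁻) 0ᴹ I) * det (block S 0ᴹ C D)
        ≈⟨ *-cong (det-block-unitriangular (B *ᴹ D⁻)) (det-block-lower S C D) ⟩
      1# * (det S * det D)
        ≈⟨ trans (*-identityˡ _) (*-comm _ _) ⟩
      det D * det S ∎
      where
      S : Matrix m m
      S = A -ᴹ B *ᴹ D⁻ *ᴹ C
      e₁₁ : I *ᴹ S +ᴹ B *ᴹ D⁻ *ᴹ C ≈ᴹ A
      e₁₁ i j = trans (+-congʳ (*ᴹ-identityˡ S i j)) (//-rightDividesˡ ((B *ᴹ D⁻ *ᴹ C) i j) (A i j))
      e₁₂ : I *ᴹ 0ᴹ +ᴹ B *ᴹ D⁻ *ᴹ D ≈ᴹ B
      e₁₂ i j = begin
        (I {m} *ᴹ 0ᴹ {m} {n}) i j + (B *ᴹ D⁻ *ᴹ D) i j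
          ≈⟨ +-cong (*ᴹ-zeroʳ (I {m}) i j) (*ᴹ-assoc B D⁻ D i j) ⟩
        0# + (B *ᴹ (D⁻ *ᴹ D)) i j
          ≈⟨ +-identityˡ _ ⟩
        (B *ᴹ (D⁻ *ᴹ D)) i j
          ≈⟨ *ᴹ-cong {M = B} (λ _ _ → refl) D⁻D≈I i j ⟩
        (B *ᴹ I) i j
          ≈⟨ *ᴹ-identityʳ B i j ⟩
        B i j ∎
      e₂₁ : 0ᴹ *ᴹ S +ᴹ I *ᴹ C ≈ᴹ C
      e₂₁ i j = trans (+-cong (*ᴹ-zeroˡ {n} S i j) (*ᴹ-identityˡ C i j)) (+-identityˡ _)
      e₂₂ : 0ᴹ {n} {m} *ᴹ 0ᴹ +ᴹ I *ᴹ D ≈ᴹ D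
      e₂₂ i j = trans (+-cong (*ᴹ-zeroˡ {n} (0ᴹ {m} {n}) i j) (*ᴹ-identityˡ D i j)) (+-identityˡ _)

    -- The mirrored factorisation is (A, 0; C, S) times (I, A⁻B; 0, I). Its upper right block is
    -- AA⁻B, so `A⁻` has to cancel A from the right; the bracketing of CA⁻B follows the second
    -- factor.
    schur-upperLeft : ∀ (A⁻ : Matrix m m) → A *ᴹ A⁻ ≈ᴹ I →
                      det (block A B C D) ≈ det A * det (D -ᴹ C *ᴹ (A⁻ *ᴹ B))
    schur-upperLeft A⁻ AA⁻≈I = begin
      det (block A B C D)
        ≈⟨ det-cong (λ i j → trans (block-*ᴹ A 0ᴹ C S I (A⁻ *ᴹ B) 0ᴹ I i j) (block-cong e₁₁ e₁₂ e₂₁ e₂₂ i j)) ⟨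
      det (block A 0ᴹ C S *ᴹ block I (A⁻ *ᴹ B) 0ᴹ I)
        ≈⟨ det-*ᴹ (block A 0ᴹ C S) (block I (A⁻ *ᴹ B) 0ᴹ I) ⟩
      det (block A 0ᴹ C S) * det (block I (A⁻ *ᴹ B) 0ᴹ I)
        ≈⟨ *-cong (det-block-lower A C S) (det-block-unitriangular (A⁻ *ᴹ B)) ⟩
      det A * det S * 1#
        ≈⟨ *-identityʳ _ ⟩
      det A * det S ∎
      where
      S : Matrix n n
      S = D -ᴹ C *ᴹ (A⁻ *ᴹ B)
      e₁₁ : A *ᴹ I +ᴹ 0ᴹ *ᴹ 0ᴹ {n} ≈ᴹ A
      e₁₁ i j = trans (+-cong (*ᴹ-identityʳ A i j) (*ᴹ-zeroˡ {m} (0ᴹ {n} {m}) i j)) (+-identityʳ _)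
      e₁₂ : A *ᴹ (A⁻ *ᴹ B) +ᴹ 0ᴹ *ᴹ I ≈ᴹ B
      e₁₂ i j = begin
        (A *ᴹ (A⁻ *ᴹ B)) i j + (0ᴹ {m} *ᴹ I {n}) i j
          ≈⟨ +-cong (sym (*ᴹ-assoc A A⁻ B i j)) (*ᴹ-zeroˡ {m} (I {n}) i j) ⟩
        (A *ᴹ A⁻ *ᴹ B) i j + 0#
          ≈⟨ +-identityʳ _ ⟩
        (A *ᴹ A⁻ *ᴹ B) i j
          ≈⟨ *ᴹ-cong {N = B} AA⁻≈I (λ _ _ → refl) i j ⟩
        (I *ᴹ B) i j
          ≈⟨ *ᴹ-identityˡ B i j ⟩
        B i j ∎
      e₂₁ : C *ᴹ I +ᴹ S *ᴹ 0ᴹ ≈ᴹ C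
      e₂₁ i j = trans (+-cong (*ᴹ-identityʳ C i j) (*ᴹ-zeroʳ S i j)) (+-identityʳ _)
      e₂₂ : C *ᴹ (A⁻ *ᴹ B) +ᴹ S *ᴹ I ≈ᴹ D
      e₂₂ i j = trans (+-congˡ (*ᴹ-identityʳ S i j))
        (trans (+-comm _ _) (//-rightDividesˡ ((C *ᴹ (A⁻ *ᴹ B)) i j) (D i j)))

  -- Coronals and rank-one perturbations

  -- The sum of all entries, in exactly the form to which the 1 × 1 product in `Γ` unfolds. The
  -- factors 1# are kept so that the coronal is this expression by definition.
  grandSum : ∀ {n} → Matrix n n → Carrier
  grandSum N = sum λ j → sum (λ i → 1# * N i j) * 1#

  𝟏 : ∀ {m n} → Matrix m n
  𝟏 _ _ = 1#

  det-1×1 : ∀ (M : Matrix 1 1) → det M ≈ M zero zero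
  det-1×1 M = trans (+-identityʳ _) (trans (*-identityʳ _) (*-identityˡ _))

  -- Both Schur complements of the bordered matrix with blocks U, 1, γ1ᵀ, 1.
  det-minus-constant : ∀ {n} (U U⁻ : Matrix n n) → U *ᴹ U⁻ ≈ᴹ I → ∀ γ →
                       det (λ i j → U i j - γ) ≈ det U * (1# - γ * grandSum U⁻)
  det-minus-constant {n} U U⁻ UU⁻≈I γ = begin
    det (λ i j → U i j - γ)
      ≈⟨ det-cong (λ i j → +-congˡ (-‿cong (rank-one i j))) ⟨
    det (U -ᴹ 𝟏 *ᴹ I *ᴹ C)
      ≈⟨ trans (*-congʳ (det-I 1)) (*-identityˡ _) ⟨
    det (I {1}) * det (U -ᴹ 𝟏 *ᴹ I *ᴹ C)
      ≈⟨ schur-lowerRight U 𝟏 C I I (*ᴹ-identityˡ I) ⟨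
    det (block U 𝟏 C I)
      ≈⟨ schur-upperLeft U 𝟏 C I U⁻ UU⁻≈I ⟩
    det U * det (I -ᴹ C *ᴹ (U⁻ *ᴹ 𝟏))
      ≈⟨ *-congˡ (trans (det-1×1 (I -ᴹ C *ᴹ (U⁻ *ᴹ 𝟏))) (+-congˡ (-‿cong total))) ⟩
    det U * (1# - γ * grandSum U⁻) ∎
    where
    C : Matrix 1 n
    C _ _ = γ
    rank-one : ∀ i j → (𝟏 {n} {1} *ᴹ I *ᴹ C) i j ≈ γ
    rank-one i j = trans (+-identityʳ _) (trans (*-congʳ {γ} (*ᴹ-identityʳ (𝟏 {n} {1}) i zero)) (*-identityˡ γ))
    total : (C *ᴹ (U⁻ *ᴹ 𝟏 {n} {1})) zero zero ≈ γ * grandSum U⁻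
    total = begin
      sum (λ i → γ * sum (λ j → U⁻ i j * 1#))
        ≈⟨ *-distribˡ-sum γ (λ i → sum (λ j → U⁻ i j * 1#)) ⟨
      γ * sum (λ i → sum (λ j → U⁻ i j * 1#))
        ≈⟨ *-congˡ (∑-comm (λ i j → U⁻ i j * 1#)) ⟩
      γ * sum (λ j → sum (λ i → U⁻ i j * 1#))
        ≈⟨ *-congˡ (sum-cong-≋ λ j → trans (sum-cong-≋ λ i → *-comm (U⁻ i j) 1#) (sym (*-identityʳ _))) ⟩
      γ * grandSum U⁻ ∎

  -- Every entry of the product `𝟏 *ᴹ V⁻ *ᴹ 𝟏` is `grandSum V⁻` by definition, so the Schur
  -- complement already has the shape treated by `det-minus-constant`.
  det-join : ∀ {m n} (U U⁻ : Matrix m m) (V V⁻ : Matrix n n) → U *ᴹ U⁻ ≈ᴹ I → V⁻ *ᴹ V ≈ᴹ I →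
             det (block U 𝟏 𝟏 V) ≈ det V * (det U * (1# - grandSum V⁻ * grandSum U⁻))
  det-join U U⁻ V V⁻ UU⁻≈I V⁻V≈I = trans (schur-lowerRight U 𝟏 𝟏 V V⁻ V⁻V≈I)
    (*-congˡ (det-minus-constant U U⁻ UU⁻≈I (grandSum V⁻)))

  det-splittingJoin : ∀ {m n} (U E P P⁻ S⁻ : Matrix m m) (V V⁻ : Matrix n n) →
    P⁻ *ᴹ P ≈ᴹ I → V⁻ *ᴹ V ≈ᴹ I → (U -ᴹ E *ᴹ P⁻ *ᴹ E) *ᴹ S⁻ ≈ᴹ I →
    det (block (block U 𝟏 𝟏 V) (E ++ 0ᴹ) (λ i → E i ++ const 0#) P) ≈
    det V * det P * det (U -ᴹ E *ᴹ P⁻ *ᴹ E) * (1# - grandSum V⁻ * grandSum S⁻)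
  det-splittingJoin {m} {n} U E P P⁻ S⁻ V V⁻ P⁻P≈I V⁻V≈I SS⁻≈I = begin
    det (block (block U 𝟏 𝟏 V) F F′ P)
      ≈⟨ schur-lowerRight (block U 𝟏 𝟏 V) F F′ P P⁻ P⁻P≈I ⟩
    det P * det (block U 𝟏 𝟏 V -ᴹ F *ᴹ P⁻ *ᴹ F′)
      ≈⟨ *-congˡ (trans (det-cong reduce) (det-join S S⁻ V V⁻ SS⁻≈I V⁻V≈I)) ⟩
    det P * (det V * (det S * Δ))
      ≈⟨ solve 4 (λ p v s d → p :* (v :* (s :* d)) := v :* p :* s :* d) refl (det P) (det V) (det S) Δ ⟩
    det V * det P * det S * Δ ∎
    where
    F : Matrix (m ℕ.+ n) m
    F = E ++ 0ᴹ
    F′ : Matrix m (m ℕ.+ n)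
    F′ i = E i ++ const 0#
    S : Matrix m m
    S = U -ᴹ E *ᴹ P⁻ *ᴹ E
    Δ : Carrier
    Δ = 1# - grandSum V⁻ * grandSum S⁻

    x-0≈x : ∀ {x y z} → x ≡ y → z ≈ 0# → x - z ≈ y
    x-0≈x {x} {y} {z} x≡y z≈0 = begin
      x - z    ≈⟨ +-cong (reflexive x≡y) (-‿cong z≈0) ⟩
      y - 0#   ≈⟨ +-congˡ -0#≈0# ⟩
      y + 0#   ≈⟨ +-identityʳ y ⟩
      y        ∎

    F₁ : ∀ i k → F (i ↑ˡ n) k ≡ E i k
    F₁ i k = ≡.cong-app (lookup-++ˡ E 0ᴹ i) k
    F₂ : ∀ i k → F (m ↑ʳ i) k ≡ 0#
    F₂ i k = ≡.cong-app (lookup-++ʳ E (0ᴹ {n}) i) k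
    F′₁ : ∀ k j → F′ k (j ↑ˡ n) ≡ E k j
    F′₁ k = lookup-++ˡ (E k) (const 0#)
    F′₂ : ∀ k j → F′ k (m ↑ʳ j) ≡ 0#
    F′₂ k = lookup-++ʳ (E k) (const 0#)

    -- The zero rows of F and the zero columns of `F′` confine F P⁻ F′ to the corner occupied by U.
    vanish-row : ∀ i j → (F *ᴹ P⁻ *ᴹ F′) (m ↑ʳ i) j ≈ 0#
    vanish-row i j = sum-zero λ k → trans (*-congʳ {F′ k j}
      (sum-zero λ r → trans (*-congʳ {P⁻ r k} (reflexive (F₂ i r))) (zeroˡ _))) (zeroˡ _)
    vanish-column : ∀ i j → (F *ᴹ P⁻ *ᴹ F′) i (m ↑ʳ j) ≈ 0#
    vanish-column i j = sum-zero λ k → trans (*-congˡ {(F *ᴹ P⁻) i k} (reflexive (F′₂ k j))) (zeroʳ _)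

    reduce : block U 𝟏 𝟏 V -ᴹ F *ᴹ P⁻ *ᴹ F′ ≈ᴹ block S 𝟏 𝟏 V
    reduce = ≈ᴹ-block
      (λ i j → +-cong (reflexive (block-₁₁ U 𝟏 𝟏 V i j)) (-‿cong (sum-cong-≋ λ k → *-cong
        (sum-cong-≋ λ r → *-congʳ {P⁻ r k} (reflexive (F₁ i r))) (reflexive (F′₁ k j)))))
      (λ i j → x-0≈x (block-₁₂ U 𝟏 𝟏 V i j) (vanish-column (i ↑ˡ n) j))
      (λ i j → x-0≈x (block-₂₁ U 𝟏 𝟏 V i j) (vanish-row i (j ↑ˡ n)))
      (λ i j → x-0≈x (block-₂₂ U 𝟏 𝟏 V i j) (vanish-row i (m ↑ʳ j)))

  -- The inverse matrix itself is kept and only the proofs change, so a coronal formed with the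
  -- transported proof uses the same matrix definitionally.
  Invertible-resp-≈ᴹ : ∀ {n} {M N : Matrix n n} → M ≈ᴹ N → Invertible M → Invertible N
  Invertible-resp-≈ᴹ {M = M} {N} M≈N (K , KM≈I , MK≈I) = K ,
    (λ i j → trans (*ᴹ-cong {M = K} {N = N} (λ _ _ → refl) (λ k l → sym (M≈N k l)) i j) (KM≈I i j)) ,
    (λ i j → trans (*ᴹ-cong {M = N} {N = K} (λ k l → sym (M≈N k l)) (λ _ _ → refl) i j) (MK≈I i j))

  schur-invertible : ∀ {m n} (A : Matrix m m) (B : Matrix m n) (C : Matrix n m) (D D⁻ : Matrix n n) u →
                     D⁻ *ᴹ D ≈ᴹ I → det (block A B C D) * u ≈ 1# → Invertible (A -ᴹ B *ᴹ D⁻ *ᴹ C)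
  schur-invertible A B C D D⁻ u D⁻D≈I unit = unit-det⇒invertible S (det D * u) (begin
    det S * (det D * u)    ≈⟨ solve 3 (λ s d u → s :* (d :* u) := d :* s :* u) refl (det S) (det D) u ⟩
    det D * det S * u      ≈⟨ *-congʳ (schur-lowerRight A B C D D⁻ D⁻D≈I) ⟨
    det (block A B C D) * u ≈⟨ unit ⟩
    1#                     ∎)
    where
    S = A -ᴹ B *ᴹ D⁻ *ᴹ C

-- Degrees

count : ∀ {n} → (Fin n → Bool) → ℕ
count f = ∣ tabulate f ∣

count-cong : ∀ {n} {f g : Fin n → Bool} → (∀ i → f i ≡ g i) → count f ≡ count g
count-cong f≡g = ≡.cong ∣_∣ (tabulate-cong f≡g)

count-true : ∀ n → count {n} (const true) ≡ n
count-true zero    = ≡.refl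
count-true (suc n) = ≡.cong suc (count-true n)

count-false : ∀ n → count {n} (const false) ≡ 0
count-false zero    = ≡.refl
count-false (suc n) = count-false n

count-++ : ∀ m {n} (f : Fin (m ℕ.+ n) → Bool) →
           count f ≡ count (λ i → f (i ↑ˡ n)) ℕ.+ count (λ j → f (m ↑ʳ j))
count-++ zero    f = ≡.refl
count-++ (suc m) f with f zero
... | true  = ≡.cong suc (count-++ m (f ∘ suc))
... | false = count-++ m (f ∘ suc)

count-not : ∀ {n} (f : Fin n → Bool) → count f ℕ.+ count (not ∘ f) ≡ n
count-not {zero}  f = ≡.refl
count-not {suc n} f with f zero
... | true  = ≡.cong suc (count-not (f ∘ suc))
... | false = ≡.trans (ℕₚ.+-suc _ _) (≡.cong suc (count-not (f ∘ suc)))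

-- Every index other than i is counted exactly once, by f or by its negation. The index i is counted
-- by neither, which accounts for the successor.
count-not-except : ∀ {n} (f : Fin n → Bool) i → f i ≡ false →
                   suc (count f ℕ.+ count (λ j → not (does (i ≟ j)) ∧ not (f j))) ≡ n
count-not-except f zero    fᵢ≡false with f zero | fᵢ≡false
... | false | ≡.refl = ≡.cong suc (count-not (f ∘ suc))
count-not-except f (suc i) fᵢ≡false with f zero
... | true  = ≡.cong suc (count-not-except (f ∘ suc) i fᵢ≡false)
... | false = ≡.cong suc (≡.trans (ℕₚ.+-suc _ _) (count-not-except (f ∘ suc) i fᵢ≡false))

degree-complement : ∀ {n} (G : Graph n) i → suc (degree G i ℕ.+ degree (complement G) i) ≡ n
degree-complement G i = count-not-except (adj G i) i (adj-irrefl G i)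

-- Joins u′ᵢ to uⱼ precisely when ij is an edge of G; the NS and NNS joins are the cases
-- G = G₁ and G = complement G₁.
splittingJoin : ∀ {m n} → Graph m → Graph m → Graph n → Graph ((m ℕ.+ n) ℕ.+ m)
splittingJoin {m} G G₁ G₂ = addVertices (G₁ ∨ G₂) λ i v → [ adj G i , const false ]′ (splitAt m v)

module _ {m n} (G G₁ : Graph m) (G₂ : Graph n) where

  private
    H : Graph ((m ℕ.+ n) ℕ.+ m)
    H = splittingJoin G G₁ G₂

  original₁ new : Fin m → Fin ((m ℕ.+ n) ℕ.+ m)
  original₁ i = (i ↑ˡ n) ↑ˡ m
  new i       = (m ℕ.+ n) ↑ʳ i

  original₂ : Fin n → Fin ((m ℕ.+ n) ℕ.+ m)
  original₂ k = (m ↑ʳ k) ↑ˡ m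

  adj₁₁ : ∀ i j → adj H (original₁ i) (original₁ j) ≡ adj G₁ i j
  adj₁₁ i j rewrite splitAt-↑ˡ (m ℕ.+ n) (i ↑ˡ n) m | splitAt-↑ˡ (m ℕ.+ n) (j ↑ˡ n) m
    | splitAt-↑ˡ m i n | splitAt-↑ˡ m j n = ≡.refl

  adj₁₂ : ∀ i k → adj H (original₁ i) (original₂ k) ≡ true
  adj₁₂ i k rewrite splitAt-↑ˡ (m ℕ.+ n) (i ↑ˡ n) m | splitAt-↑ˡ (m ℕ.+ n) (m ↑ʳ k) m
    | splitAt-↑ˡ m i n | splitAt-↑ʳ m n k = ≡.refl

  adj₂₁ : ∀ k j → adj H (original₂ k) (original₁ j) ≡ true
  adj₂₁ k j = ≡.trans (adj-sym H (original₂ k) (original₁ j)) (adj₁₂ j k)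

  adj₂₂ : ∀ k l → adj H (original₂ k) (original₂ l) ≡ adj G₂ k l
  adj₂₂ k l rewrite splitAt-↑ˡ (m ℕ.+ n) (m ↑ʳ k) m | splitAt-↑ˡ (m ℕ.+ n) (m ↑ʳ l) m
    | splitAt-↑ʳ m n k | splitAt-↑ʳ m n l = ≡.refl

  adj₃₁ : ∀ i j → adj H (new i) (original₁ j) ≡ adj G i j
  adj₃₁ i j rewrite splitAt-↑ʳ (m ℕ.+ n) m i | splitAt-↑ˡ (m ℕ.+ n) (j ↑ˡ n) m
    | splitAt-↑ˡ m j n = ≡.refl

  adj₃₂ : ∀ i k → adj H (new i) (original₂ k) ≡ false
  adj₃₂ i k rewrite splitAt-↑ʳ (m ℕ.+ n) m i | splitAt-↑ˡ (m ℕ.+ n) (m ↑ʳ k) m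
    | splitAt-↑ʳ m n k = ≡.refl

  adj₃₃ : ∀ i j → adj H (new i) (new j) ≡ false
  adj₃₃ i j rewrite splitAt-↑ʳ (m ℕ.+ n) m i | splitAt-↑ʳ (m ℕ.+ n) m j = ≡.refl

  adj₁₃ : ∀ i j → adj H (original₁ i) (new j) ≡ adj G i j
  adj₁₃ i j = ≡.trans (adj-sym H (original₁ i) (new j)) (≡.trans (adj₃₁ j i) (adj-sym G j i))

  adj₂₃ : ∀ k j → adj H (original₂ k) (new j) ≡ false
  adj₂₃ k j = ≡.trans (adj-sym H (original₂ k) (new j)) (adj₃₂ j k)

  count₃ : ∀ (f : Fin ((m ℕ.+ n) ℕ.+ m) → Bool) →
           count f ≡ count (f ∘ original₁) ℕ.+ count (f ∘ original₂) ℕ.+ count (f ∘ new)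
  count₃ f = ≡.trans (count-++ (m ℕ.+ n) f) (≡.cong (ℕ._+ count (f ∘ new)) (count-++ m (λ v → f (v ↑ˡ m))))

  degree-original₁ : ∀ i → degree H (original₁ i) ≡ degree G₁ i ℕ.+ n ℕ.+ degree G i
  degree-original₁ i = ≡.trans (count₃ (adj H (original₁ i)))
    (≡.cong₂ ℕ._+_ (≡.cong₂ ℕ._+_ (count-cong (adj₁₁ i)) (≡.trans (count-cong (adj₁₂ i)) (count-true n)))
      (count-cong (adj₁₃ i)))

  degree-original₂ : ∀ k → degree H (original₂ k) ≡ m ℕ.+ degree G₂ k
  degree-original₂ k = ≡.trans (count₃ (adj H (original₂ k)))
    (≡.trans (≡.cong₂ ℕ._+_ (≡.cong₂ ℕ._+_ (≡.trans (count-cong (adj₂₁ k)) (count-true m)) (count-cong (adj₂₂ k)))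
      (≡.trans (count-cong (adj₂₃ k)) (count-false m))) (ℕₚ.+-identityʳ _))

  degree-new : ∀ i → degree H (new i) ≡ degree G i
  degree-new i = ≡.trans (count₃ (adj H (new i)))
    (≡.trans (≡.cong₂ ℕ._+_ (≡.cong₂ ℕ._+_ (count-cong (adj₃₁ i)) (≡.trans (count-cong (adj₃₂ i)) (count-false n)))
      (≡.trans (count-cong (adj₃₃ i)) (count-false m)))
      (≡.trans (ℕₚ.+-identityʳ _) (ℕₚ.+-identityʳ _)))

≟-injective : ∀ {m n} (f : Fin m → Fin n) → (∀ {i j} → f i ≡ f j → i ≡ j) →
              ∀ i j → does (f i ≟ f j) ≡ does (i ≟ j)
≟-injective f f-inj i j = does-⇔ (mk⇔ f-inj (≡.cong f)) (f i ≟ f j) (i ≟ j)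

≟-disjoint : ∀ {m n} (i : Fin m) (j : Fin n) → does ((i ↑ˡ n) ≟ (m ↑ʳ j)) ≡ false
≟-disjoint {m} {n} i j = dec-false ((i ↑ˡ n) ≟ (m ↑ʳ j)) λ eq →
  case ≡.trans (≡.sym (splitAt-↑ˡ m i n)) (≡.trans (≡.cong (splitAt m) eq) (splitAt-↑ʳ m n j)) of λ ()

-- The matrix xI - L of a splitting join in blocks

module Laplacians {c ℓ} (R : CommutativeRing c ℓ) where

  open CommutativeRing R hiding (_-_; zero)
  open Matrices rawRing hiding (Carrier; _≈_; _+_; _*_; -_; 0#; 1#)
  open Determinants R
  open import Algebra.Properties.Ring ring using (-‿involutive; -‿+-comm)
  open import Algebra.Properties.Semiring.Mult semiring using (×-homo-+)
  open import Relation.Binary.Reasoning.Setoid setoid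

  diagonal-cong : ∀ {n} {d e : Vector Carrier n} → (∀ i → d i ≈ e i) → diagonal d ≈ᴹ diagonal e
  diagonal-cong d≈e i j with does (i ≟ j)
  ... | true  = d≈e i
  ... | false = refl

  diagonal-+ : ∀ {n} (d e : Vector Carrier n) → diagonal d +ᴹ diagonal e ≈ᴹ diagonal (λ i → d i + e i)
  diagonal-+ d e i j with does (i ≟ j)
  ... | true  = refl
  ... | false = +-identityˡ 0#

  diagonal-- : ∀ {n} (d e : Vector Carrier n) → diagonal d -ᴹ diagonal e ≈ᴹ diagonal (λ i → d i - e i)
  diagonal-- d e i j with does (i ≟ j)
  ... | true  = refl
  ... | false = -‿inverseʳ 0#

  diagonal-reindex : ∀ {m n} (g : Fin m → Fin n) → (∀ {i j} → g i ≡ g j → i ≡ j) →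
                     ∀ (d : Vector Carrier n) i j → diagonal d (g i) (g j) ≡ diagonal (d ∘ g) i j
  diagonal-reindex g g-inj d i j = ≡.cong (if_then d (g i) else 0#) (≟-injective g g-inj i j)

  diagonal-↑ˡ↑ʳ : ∀ {m n} (d : Vector Carrier (m ℕ.+ n)) i j → diagonal d (i ↑ˡ n) (m ↑ʳ j) ≡ 0#
  diagonal-↑ˡ↑ʳ d i j = ≡.cong (if_then d (i ↑ˡ _) else 0#) (≟-disjoint i j)

  diagonal-↑ʳ↑ˡ : ∀ {m n} (d : Vector Carrier (m ℕ.+ n)) j i → diagonal d (m ↑ʳ j) (i ↑ˡ n) ≡ 0#
  diagonal-↑ʳ↑ˡ {m} {n} d j i = ≡.cong (if_then d (m ↑ʳ j) else 0#)
    (≡.trans (does-⇔ (mk⇔ ≡.sym ≡.sym) ((m ↑ʳ j) ≟ (i ↑ˡ n)) ((i ↑ˡ n) ≟ (m ↑ʳ j))) (≟-disjoint i j))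

  x-[y-z] : ∀ x y z → x - (y - z) ≈ (x - y) + z
  x-[y-z] x y z = begin
    x - (y - z)        ≈⟨ +-congˡ (-‿+-comm y (- z)) ⟨
    x + (- y + - - z)  ≈⟨ +-assoc x (- y) (- - z) ⟨
    (x - y) + - - z    ≈⟨ +-congˡ (-‿involutive z) ⟩
    (x - y) + z        ∎

  ι-+ : ∀ m n → ι (m ℕ.+ n) ≈ ι m + ι n
  ι-+ m n = ×-homo-+ 1# m n

  -- The two minus signs in front of the adjacency matrix cancel; hence the off-diagonal blocks of a
  -- join carry no sign.
  laplacian-charMatrix : ∀ {n} x (G : Graph n) →
                         x ·I -ᴹ L G ≈ᴹ diagonal (λ i → x - ι (degree G i)) +ᴹ A G
  laplacian-charMatrix x G i j = trans
    (x-[y-z] (diagonal (const x) i j) (D G i j) (A G i j))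
    (+-congʳ (diagonal-- (const x) (λ i → ι (degree G i)) i j))

  -- The diagonal blocks are prescribed only up to `≈ᴹ`, so that they can be taken to be the very
  -- expressions occurring in the theorem, where the degrees in the join are hidden in `L` and `D`.
  module _ (x : Carrier) {m n} (G G₁ : Graph m) (G₂ : Graph n) {U P : Matrix m m} {V : Matrix n n}
    (U≈ : U ≈ᴹ diagonal (λ i → x - ι (degree G₁ i ℕ.+ n ℕ.+ degree G i)) +ᴹ A G₁)
    (V≈ : V ≈ᴹ diagonal (λ k → x - ι (m ℕ.+ degree G₂ k)) +ᴹ A G₂)
    (P≈ : P ≈ᴹ diagonal (λ i → x - ι (degree G i)))
    where

    private
      H : Graph ((m ℕ.+ n) ℕ.+ m)
      H = splittingJoin G G₁ G₂

      K : Matrix ((m ℕ.+ n) ℕ.+ m) ((m ℕ.+ n) ℕ.+ m)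
      K = x ·I -ᴹ L H

      d : Vector Carrier ((m ℕ.+ n) ℕ.+ m)
      d v = x - ι (degree H v)

      A-entry : ∀ {v w b} → adj H v w ≡ b → A H v w ≈ (if b then 1# else 0#)
      A-entry eq = reflexive (≡.cong (if_then 1# else 0#) eq)

      entry : ∀ {v w y z} → diagonal d v w ≈ y → A H v w ≈ z → K v w ≈ y + z
      entry {v} {w} d≈ A≈ = trans (laplacian-charMatrix x H v w) (+-cong d≈ A≈)

      entry₀ : ∀ {v w z} → diagonal d v w ≡ 0# → A H v w ≈ z → K v w ≈ z
      entry₀ d≡ A≈ = trans (entry (reflexive d≡) A≈) (+-identityˡ _)

      diagonal-entry : ∀ {k} (g : Fin k → Fin ((m ℕ.+ n) ℕ.+ m)) → (∀ {i j} → g i ≡ g j → i ≡ j) →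
                       {e : Fin k → ℕ} → (∀ i → degree H (g i) ≡ e i) →
                       ∀ i j → diagonal d (g i) (g j) ≈ diagonal (λ i → x - ι (e i)) i j
      diagonal-entry g g-inj deg i j = trans (reflexive (diagonal-reindex g g-inj d i j))
        (diagonal-cong (λ i → reflexive (≡.cong (λ k → x - ι k) (deg i))) i j)

    laplacian-splittingJoin : K ≈ᴹ block (block U 𝟏 𝟏 V) (A G ++ 0ᴹ) (λ i → A G i ++ const 0#) P
    laplacian-splittingJoin = ≈ᴹ-block
      (≈ᴹ-block {M = λ v w → K (v ↑ˡ m) (w ↑ˡ m)}
        (λ i j → trans (entry (diagonal-entry (original₁ G G₁ G₂)
              (↑ˡ-injective n _ _ ∘ ↑ˡ-injective m _ _) (degree-original₁ G G₁ G₂) i j)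
            (A-entry (adj₁₁ G G₁ G₂ i j))) (sym (U≈ i j)))
        (λ i k → entry₀ (≡.trans
            (diagonal-reindex (_↑ˡ m) (↑ˡ-injective m _ _) d (i ↑ˡ n) (m ↑ʳ k)) (diagonal-↑ˡ↑ʳ (λ v → d (v ↑ˡ m)) i k))
            (A-entry (adj₁₂ G G₁ G₂ i k)))
        (λ k j → entry₀ (≡.trans
            (diagonal-reindex (_↑ˡ m) (↑ˡ-injective m _ _) d (m ↑ʳ k) (j ↑ˡ n)) (diagonal-↑ʳ↑ˡ (λ v → d (v ↑ˡ m)) k j))
            (A-entry (adj₂₁ G G₁ G₂ k j)))
        (λ k l → trans (entry (diagonal-entry (original₂ G G₁ G₂)
              (↑ʳ-injective m _ _ ∘ ↑ˡ-injective m _ _) (degree-original₂ G G₁ G₂) k l)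
            (A-entry (adj₂₂ G G₁ G₂ k l))) (sym (V≈ k l))))
      (λ v j → entry₀ (diagonal-↑ˡ↑ʳ d v j) (↑-elim m (λ v → A H (v ↑ˡ m) ((m ℕ.+ n) ↑ʳ j) ≈ (A G ++ 0ᴹ) v j)
        (λ i → trans (A-entry (adj₁₃ G G₁ G₂ i j))
          (reflexive (≡.sym (≡.cong-app (lookup-++ˡ (A G) (0ᴹ {n}) i) j))))
        (λ k → trans (A-entry (adj₂₃ G G₁ G₂ k j))
          (reflexive (≡.sym (≡.cong-app (lookup-++ʳ (A G) (0ᴹ {n}) k) j)))) v))
      (λ i w → entry₀ (diagonal-↑ʳ↑ˡ d i w) (↑-elim m (λ w → A H ((m ℕ.+ n) ↑ʳ i) (w ↑ˡ m) ≈ (A G i ++ const 0#) w)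
        (λ j → trans (A-entry (adj₃₁ G G₁ G₂ i j))
          (reflexive (≡.sym (lookup-++ˡ (A G i) (λ (_ : Fin n) → 0#) j))))
        (λ k → trans (A-entry (adj₃₂ G G₁ G₂ i k))
          (reflexive (≡.sym (lookup-++ʳ (A G i) (λ (_ : Fin n) → 0#) k)))) w))
      (λ i j → trans (entry (diagonal-entry (new G G₁ G₂) (↑ʳ-injective (m ℕ.+ n) _ _) (degree-new G G₁ G₂) i j)
          (A-entry (adj₃₃ G G₁ G₂ i j))) (trans (+-identityʳ _) (sym (P≈ i j))))

    det-laplacian-splittingJoin : ∀ (P⁻ S⁻ : Matrix m m) (V⁻ : Matrix n n) →
      P⁻ *ᴹ P ≈ᴹ I → V⁻ *ᴹ V ≈ᴹ I → (U -ᴹ A G *ᴹ P⁻ *ᴹ A G) *ᴹ S⁻ ≈ᴹ I →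
      det (x ·I -ᴹ L H) ≈
      det V * det P * det (U -ᴹ A G *ᴹ P⁻ *ᴹ A G) * (1# - grandSum V⁻ * grandSum S⁻)
    det-laplacian-splittingJoin P⁻ S⁻ V⁻ P⁻P V⁻V SS⁻ = trans (det-cong laplacian-splittingJoin)
      (det-splittingJoin U (A G) P P⁻ S⁻ V V⁻ P⁻P V⁻V SS⁻)

-- Leading coefficients of determinants

module LeadingCoefficients {k κ c ℓ} (K : CommutativeRing k κ) (R : CommutativeRing c ℓ) where

  private
    module K where
      open CommutativeRing K public
      open import Algebra.Properties.Ring ring public using (-0#≈0#)
    module Kᴹ where
      open Matrices K.rawRing public using (Matrix; det; sum; _^_)
      open Determinants K public
  open CommutativeRing R hiding (_-_; zero)
  open Matrices rawRing hiding (Carrier; _≈_; _+_; _*_; -_; 0#; 1#)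
  open Determinants R
  open Laplacians R
  open import Algebra.Properties.Ring ring using (-‿+-comm; //-rightDividesˡ; //-rightDividesʳ)
  open import Algebra.Solver.Ring.NaturalCoefficients.Default commutativeSemiring
    using (solve; _:=_; _:+_)
  open import Relation.Binary.Reasoning.Setoid setoid

  -- T n a x is to be read as: x is aXⁿ plus terms of degree below n.
  record IsLeading {t} (T : ℕ → K.Carrier → Carrier → Set t) : Set (k ⊔ κ ⊔ c ⊔ ℓ ⊔ t) where
    field
      resp  : ∀ {n a b x y} → a K.≈ b → x ≈ y → T n a x → T n b y
      plus  : ∀ {n a b x y} → T n a x → T n b y → T n (a K.+ b) (x + y)
      times : ∀ {m n a b x y} → T m a x → T n b y → T (m ℕ.+ n) (a K.* b) (x * y)
      minus : ∀ {n a x} → T n a x → T n (K.- a) (- x)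
      one   : T 0 K.1# 1#
      nil   : ∀ {n} → T n K.0# 0#
      raise : ∀ {n a x} → T n a x → T (suc n) K.0# x

  -- Division is available only through `monic⇒unit`; everything else about T is compatibility with
  -- the ring operations.
  module _ {t} {T : ℕ → K.Carrier → Carrier → Set t} (isLeading : IsLeading T)
    (monic⇒unit : ∀ {n x} → T n K.1# x → Σ[ u ∈ Carrier ] x * u ≈ 1#) where
    open IsLeading isLeading

    leading-sum : ∀ {m n} {a : Vector K.Carrier m} {x : Vector Carrier m} →
                  (∀ i → T n (a i) (x i)) → T n (Kᴹ.sum a) (sum x)
    leading-sum {zero}  Tx = nil
    leading-sum {suc m} Tx = plus (Tx zero) (leading-sum (Tx ∘ suc))

    leading-^ : ∀ {a x} m → T 0 a x → T 0 (a Kᴹ.^ m) (x ^ m)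
    leading-^ zero    Tx = one
    leading-^ (suc m) Tx = times Tx (leading-^ m Tx)

    -- The two Laplace expansions run in parallel. Signs have degree 0, the entry degree 1 and the
    -- minor degree n, so each summand is controlled in degree `suc n`.
    leading-det : ∀ {n} {N : Kᴹ.Matrix n n} {M : Matrix n n} →
                  (∀ i j → T 1 (N i j) (M i j)) → T n (Kᴹ.det N) (det M)
    leading-det {zero}  TM = one
    leading-det {suc n} {N} {M} TM = leading-sum λ j →
      times (times (leading-^ (toℕ j) (minus one)) (TM zero j))
        (leading-det {N = Kᴹ.minor N j} {M = minor M j} λ i l → TM (suc i) (punchIn j l))

    -- Constants, viewed in degree one with X-coefficient zero so that they can share a matrix with
    -- the entries containing X.
    Lower : Carrier → Set t
    Lower = T 1 K.0#

    plus-lower : ∀ {a x y} → T 1 a x → Lower y → T 1 a (x + y)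
    plus-lower Tx Ty = resp (K.+-identityʳ _) refl (plus Tx Ty)

    minus-lower : ∀ {a x y} → T 1 a x → Lower y → T 1 a (x - y)
    minus-lower Tx Ty = plus-lower Tx (resp K.-0#≈0# refl (minus Ty))

    ι-lower : ∀ m → Lower (ι m)
    ι-lower zero    = nil
    ι-lower (suc m) = plus-lower (raise one) (ι-lower m)

    A-lower : ∀ {n} (G : Graph n) i j → Lower (A G i j)
    A-lower G i j with adj G i j
    ... | true  = raise one
    ... | false = nil

    D-lower : ∀ {n} (G : Graph n) i j → Lower (D G i j)
    D-lower G i j with does (i ≟ j)
    ... | true  = ι-lower (degree G i)
    ... | false = nil

    L-lower : ∀ {n} (G : Graph n) i j → Lower (L G i j)
    L-lower G i j = minus-lower (D-lower G i j) (A-lower G i j)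

    leading-·I : ∀ {n y} → T 1 K.1# y → ∀ (i j : Fin n) → T 1 (Kᴹ.I i j) ((y ·I) i j)
    leading-·I Ty i j with does (i ≟ j)
    ... | true  = Ty
    ... | false = nil

    -- The matrix of X-coefficients is the identity, whose determinant over K is 1, so det M is
    -- monic.
    leading-I⇒unit : ∀ {n} (M : Matrix n n) → (∀ i j → T 1 (Kᴹ.I i j) (M i j)) →
                     Σ[ u ∈ Carrier ] det M * u ≈ 1#
    leading-I⇒unit {n} M TM = monic⇒unit (resp (Kᴹ.det-I n) refl (leading-det TM))

    leading-I⇒invertible : ∀ {n} (M : Matrix n n) → (∀ i j → T 1 (Kᴹ.I i j) (M i j)) → Invertible M
    leading-I⇒invertible M TM with leading-I⇒unit M TM
    ... | u , unit = unit-det⇒invertible M u unit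

    -- The entries of the Schur complement involve P⁻¹ and need not be polynomials, so T cannot be
    -- applied to them. The undivided block matrix does satisfy T entrywise, with identity
    -- X-coefficients because E and `E′` are constant.
    schur-leading-I⇒invertible : ∀ {m n} (U : Matrix m m) (E : Matrix m n) (E′ : Matrix n m) (P : Matrix n n) →
      (∀ i j → T 1 (Kᴹ.I i j) (U i j)) → (∀ i j → Lower (E i j)) → (∀ i j → Lower (E′ i j)) →
      (∀ i j → T 1 (Kᴹ.I i j) (P i j)) →
      (P-inv : Invertible P) → Invertible (U -ᴹ E *ᴹ P-inv ⁻¹ *ᴹ E′)
    schur-leading-I⇒invertible {m} {n} U E E′ P TU TE TE′ TP (P⁻ , P⁻P≈I , _) =
      schur-invertible U E E′ P P⁻ (proj₁ unit) P⁻P≈I (proj₂ unit)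
      where
      leading-block : ∀ i j → T 1 (Kᴹ.block {m} {n} {m} {n} Kᴹ.I Kᴹ.0ᴹ Kᴹ.0ᴹ Kᴹ.I i j) (block U E E′ P i j)
      leading-block i j with splitAt m i
      leading-block i j | inj₁ i′ with splitAt m j
      ... | inj₁ j′ = TU i′ j′
      ... | inj₂ j′ = TE i′ j′
      leading-block i j | inj₂ i′ with splitAt m j
      ... | inj₁ j′ = TE′ i′ j′
      ... | inj₂ j′ = TP i′ j′
      unit : Σ[ u ∈ Carrier ] det (block U E E′ P) * u ≈ 1#
      unit = monic⇒unit (resp (Kᴹ.det-block-unitriangular {m} {n} Kᴹ.0ᴹ) refl (leading-det leading-block))

    -- The NNS and NS joins, at any monic x of degree one

    private
      x≈y-z : ∀ {x y z} → x + z ≈ y → x ≈ y - z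
      x≈y-z {x} {z = z} eq = trans (sym (//-rightDividesʳ z x)) (+-congʳ eq)

      swap-last : ∀ x y z → x + y + z ≈ x + z + y
      swap-last = solve 3 (λ x y z → x :+ y :+ z := x :+ z :+ y) refl

      x-y-z≈x-[y+z] : ∀ x y z → x - y - z ≈ x - (y + z)
      x-y-z≈x-[y+z] x y z = trans (+-assoc x (- y) (- z)) (+-congˡ (-‿+-comm y z))

    module _ {x : Carrier} (x-monic : T 1 K.1# x) {n₁ n₂} (G₁ : Graph n₁) (G₂ : Graph n₂) where

      private
        deg₁ : Vector Carrier n₁
        deg₁ i = ι (degree G₁ i)

        V : Matrix n₂ n₂
        V = (x - ι n₁) ·I -ᴹ L G₂

        V-leading : ∀ i j → T 1 (Kᴹ.I i j) (V i j)
        V-leading i j = minus-lower (leading-·I (minus-lower x-monic (ι-lower n₁)) i j) (L-lower G₂ i j)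

        V≈ : V ≈ᴹ diagonal (λ k → x - ι (n₁ ℕ.+ degree G₂ k)) +ᴹ A G₂
        V≈ i j = trans (laplacian-charMatrix (x - ι n₁) G₂ i j) (+-congʳ (diagonal-cong (λ k →
          trans (x-y-z≈x-[y+z] x (ι n₁) (ι (degree G₂ k))) (+-congˡ (-‿cong (sym (ι-+ n₁ (degree G₂ k)))))) i j))

      NNS-join :
        Σ[ P ∈ Invertible ((x - ι n₁ + 1#) ·I +ᴹ D G₁) ]
        let M = L G₁ -ᴹ D G₁ +ᴹ A (complement G₁) *ᴹ P ⁻¹ *ᴹ A (complement G₁) in
        Σ[ Q ∈ Invertible ((x - ι n₁) ·I -ᴹ L G₂) ]
        Σ[ S ∈ Invertible ((x - ι n₁ - ι n₂ + 1#) ·I -ᴹ M) ]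
          det (x ·I -ᴹ L (G₁ NNS∨ G₂)) ≈
              det ((x - ι n₁) ·I -ᴹ L G₂)
            * det ((x - ι n₁ + 1#) ·I +ᴹ D G₁)
            * det ((x - ι n₁ - ι n₂ + 1#) ·I -ᴹ L G₁ +ᴹ D G₁ -ᴹ A (complement G₁) *ᴹ P ⁻¹ *ᴹ A (complement G₁))
            * (1# - Γ (L G₂) (x - ι n₁) Q * Γ M (x - ι n₁ - ι n₂ + 1#) S)
      NNS-join = P-inv , V-inv , Invertible-resp-≈ᴹ S≈ S-inv ,
        det-laplacian-splittingJoin x Ḡ₁ G₁ G₂ {U} {P} {V} U≈ V≈ P≈ (P-inv ⁻¹) (S-inv ⁻¹) (V-inv ⁻¹)
          (proj₁ (proj₂ P-inv)) (proj₁ (proj₂ V-inv)) (proj₂ (proj₂ S-inv))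
        where
        Ḡ₁ : Graph n₁
        Ḡ₁ = complement G₁
        -- If uᵢ has degree d in G₁, its degree in the NNS join is d + n₂ + (n₁ - 1 - d). The d
        -- cancels, so the diagonal of U is the constant x - n₁ - n₂ + 1; adding `D G₁` in U undoes
        -- the degrees contained in `L G₁`.
        y : Carrier
        y = x - ι n₁ - ι n₂ + 1#
        U P : Matrix n₁ n₁
        U = y ·I -ᴹ L G₁ +ᴹ D G₁
        P = (x - ι n₁ + 1#) ·I +ᴹ D G₁

        P-leading : ∀ i j → T 1 (Kᴹ.I i j) (P i j)
        P-leading i j = plus-lower (leading-·I
          (plus-lower (minus-lower x-monic (ι-lower n₁)) (raise one)) i j) (D-lower G₁ i j)
        U-leading : ∀ i j → T 1 (Kᴹ.I i j) (U i j)
        U-leading i j = plus-lower (minus-lower (leading-·I (plus-lower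
          (minus-lower (minus-lower x-monic (ι-lower n₁)) (ι-lower n₂)) (raise one)) i j)
          (L-lower G₁ i j)) (D-lower G₁ i j)

        P-inv : Invertible P
        P-inv = leading-I⇒invertible P P-leading
        V-inv : Invertible V
        V-inv = leading-I⇒invertible V V-leading
        EPE : Matrix n₁ n₁
        EPE = A Ḡ₁ *ᴹ P-inv ⁻¹ *ᴹ A Ḡ₁
        S-inv : Invertible (U -ᴹ EPE)
        S-inv = schur-leading-I⇒invertible U (A Ḡ₁) (A Ḡ₁) P U-leading (A-lower Ḡ₁) (A-lower Ḡ₁) P-leading P-inv

        -- The determinant factor subtracts the summands one by one, whereas the coronal is taken of
        -- their total M. The inverse found for the first form serves for the second.
        S≈ : U -ᴹ EPE ≈ᴹ y ·I -ᴹ (L G₁ -ᴹ D G₁ +ᴹ EPE)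
        S≈ i j = trans (+-congʳ (sym (x-[y-z] ((y ·I) i j) (L G₁ i j) (D G₁ i j))))
          (x-y-z≈x-[y+z] ((y ·I) i j) (L G₁ i j - D G₁ i j) (EPE i j))

        deg+codeg : ∀ i → ι n₁ ≈ 1# + (deg₁ i + ι (degree Ḡ₁ i))
        deg+codeg i = trans (reflexive (≡.cong ι (≡.sym (degree-complement G₁ i))))
          (+-congˡ (ι-+ (degree G₁ i) (degree Ḡ₁ i)))

        U-diagonal : ∀ i → y ≈ x - ι (degree G₁ i ℕ.+ n₂ ℕ.+ degree Ḡ₁ i)
        U-diagonal i = x≈y-z (begin
          x - ι n₁ - ι n₂ + 1# + ι (degree G₁ i ℕ.+ n₂ ℕ.+ degree Ḡ₁ i)
            ≈⟨ +-congˡ (trans (ι-+ (degree G₁ i ℕ.+ n₂) (degree Ḡ₁ i)) (+-congʳ (ι-+ (degree G₁ i) n₂))) ⟩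
          x - ι n₁ - ι n₂ + 1# + (deg₁ i + ι n₂ + ι (degree Ḡ₁ i))
            ≈⟨ solve 6 (λ x₁ m₂ n₂ d e o → x₁ :+ m₂ :+ o :+ (d :+ n₂ :+ e) := x₁ :+ m₂ :+ n₂ :+ (o :+ (d :+ e)))
                 refl (x - ι n₁) (- ι n₂) (ι n₂) (deg₁ i) (ι (degree Ḡ₁ i)) 1# ⟩
          x - ι n₁ - ι n₂ + ι n₂ + (1# + (deg₁ i + ι (degree Ḡ₁ i)))
            ≈⟨ +-cong (//-rightDividesˡ (ι n₂) (x - ι n₁)) (sym (deg+codeg i)) ⟩
          x - ι n₁ + ι n₁
            ≈⟨ //-rightDividesˡ (ι n₁) x ⟩
          x ∎)

        U≈ : U ≈ᴹ diagonal (λ i → x - ι (degree G₁ i ℕ.+ n₂ ℕ.+ degree Ḡ₁ i)) +ᴹ A G₁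
        U≈ i j = begin
          (y ·I) i j - (D G₁ i j - A G₁ i j) + D G₁ i j
            ≈⟨ +-congʳ (x-[y-z] ((y ·I) i j) (D G₁ i j) (A G₁ i j)) ⟩
          (y ·I) i j - D G₁ i j + A G₁ i j + D G₁ i j
            ≈⟨ swap-last ((y ·I) i j - D G₁ i j) (A G₁ i j) (D G₁ i j) ⟩
          (y ·I) i j - D G₁ i j + D G₁ i j + A G₁ i j
            ≈⟨ +-congʳ (//-rightDividesˡ (D G₁ i j) ((y ·I) i j)) ⟩
          (y ·I) i j + A G₁ i j
            ≈⟨ +-congʳ (diagonal-cong U-diagonal i j) ⟩
          diagonal (λ i → x - ι (degree G₁ i ℕ.+ n₂ ℕ.+ degree Ḡ₁ i)) i j + A G₁ i j ∎

        -- A new vertex has degree n₁ - 1 - d, so d returns with a plus sign: this is the `+ᴹ D G₁`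
        -- in P.
        P≈ : P ≈ᴹ diagonal (λ i → x - ι (degree Ḡ₁ i))
        P≈ i j = trans (diagonal-+ (const (x - ι n₁ + 1#)) deg₁ i j) (diagonal-cong (λ i → x≈y-z (begin
          x - ι n₁ + 1# + deg₁ i + ι (degree Ḡ₁ i)
            ≈⟨ solve 4 (λ x₁ o d e → x₁ :+ o :+ d :+ e := x₁ :+ (o :+ (d :+ e)))
                 refl (x - ι n₁) 1# (deg₁ i) (ι (degree Ḡ₁ i)) ⟩
          x - ι n₁ + (1# + (deg₁ i + ι (degree Ḡ₁ i)))
            ≈⟨ +-congˡ (deg+codeg i) ⟨
          x - ι n₁ + ι n₁
            ≈⟨ //-rightDividesˡ (ι n₁) x ⟩
          x ∎)) i j)

      NS-join :
        Σ[ P ∈ Invertible (x ·I -ᴹ D G₁) ]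
        let M = L G₁ +ᴹ D G₁ +ᴹ A G₁ *ᴹ P ⁻¹ *ᴹ A G₁ in
        Σ[ Q ∈ Invertible ((x - ι n₁) ·I -ᴹ L G₂) ]
        Σ[ S ∈ Invertible ((x - ι n₂) ·I -ᴹ M) ]
          det (x ·I -ᴹ L (G₁ NS∨ G₂)) ≈
              det ((x - ι n₁) ·I -ᴹ L G₂)
            * det (x ·I -ᴹ D G₁)
            * det ((x - ι n₂) ·I -ᴹ L G₁ -ᴹ D G₁ -ᴹ A G₁ *ᴹ P ⁻¹ *ᴹ A G₁)
            * (1# - Γ (L G₂) (x - ι n₁) Q * Γ M (x - ι n₂) S)
      NS-join = P-inv , V-inv , Invertible-resp-≈ᴹ S≈ S-inv ,
        det-laplacian-splittingJoin x G₁ G₁ G₂ {U} {P} {V} U≈ V≈ P≈ (P-inv ⁻¹) (S-inv ⁻¹) (V-inv ⁻¹)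
          (proj₁ (proj₂ P-inv)) (proj₁ (proj₂ V-inv)) (proj₂ (proj₂ S-inv))
        where
        y : Carrier
        y = x - ι n₂
        U P : Matrix n₁ n₁
        U = y ·I -ᴹ L G₁ -ᴹ D G₁
        P = x ·I -ᴹ D G₁

        P-leading : ∀ i j → T 1 (Kᴹ.I i j) (P i j)
        P-leading i j = minus-lower (leading-·I x-monic i j) (D-lower G₁ i j)
        U-leading : ∀ i j → T 1 (Kᴹ.I i j) (U i j)
        U-leading i j = minus-lower (minus-lower (leading-·I (minus-lower x-monic (ι-lower n₂)) i j)
          (L-lower G₁ i j)) (D-lower G₁ i j)

        P-inv : Invertible P
        P-inv = leading-I⇒invertible P P-leading
        V-inv : Invertible V
        V-inv = leading-I⇒invertible V V-leading
        EPE : Matrix n₁ n₁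
        EPE = A G₁ *ᴹ P-inv ⁻¹ *ᴹ A G₁
        S-inv : Invertible (U -ᴹ EPE)
        S-inv = schur-leading-I⇒invertible U (A G₁) (A G₁) P U-leading (A-lower G₁) (A-lower G₁) P-leading P-inv

        S≈ : U -ᴹ EPE ≈ᴹ y ·I -ᴹ (L G₁ +ᴹ D G₁ +ᴹ EPE)
        S≈ i j = trans (+-congʳ (x-y-z≈x-[y+z] ((y ·I) i j) (L G₁ i j) (D G₁ i j)))
          (x-y-z≈x-[y+z] ((y ·I) i j) (L G₁ i j + D G₁ i j) (EPE i j))

        -- In the NS join uᵢ gains as many new neighbours as it has in G₁, so its degree is d + n₂ +
        -- d. One d comes from `L G₁`, the other from the extra `D G₁`.
        U-diagonal : ∀ i → y - deg₁ i - deg₁ i ≈ x - ι (degree G₁ i ℕ.+ n₂ ℕ.+ degree G₁ i)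
        U-diagonal i = begin
          x - ι n₂ - deg₁ i - deg₁ i
            ≈⟨ +-congʳ (swap-last x (- ι n₂) (- deg₁ i)) ⟩
          x - deg₁ i - ι n₂ - deg₁ i
            ≈⟨ +-congʳ (x-y-z≈x-[y+z] x (deg₁ i) (ι n₂)) ⟩
          x - (deg₁ i + ι n₂) - deg₁ i
            ≈⟨ x-y-z≈x-[y+z] x (deg₁ i + ι n₂) (deg₁ i) ⟩
          x - (deg₁ i + ι n₂ + deg₁ i)
            ≈⟨ +-congˡ (-‿cong (trans (ι-+ (degree G₁ i ℕ.+ n₂) (degree G₁ i)) (+-congʳ (ι-+ (degree G₁ i) n₂)))) ⟨
          x - ι (degree G₁ i ℕ.+ n₂ ℕ.+ degree G₁ i) ∎

        U≈ : U ≈ᴹ diagonal (λ i → x - ι (degree G₁ i ℕ.+ n₂ ℕ.+ degree G₁ i)) +ᴹ A G₁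
        U≈ i j = begin
          (y ·I) i j - (D G₁ i j - A G₁ i j) - D G₁ i j
            ≈⟨ +-congʳ (laplacian-charMatrix y G₁ i j) ⟩
          diagonal (λ i → y - deg₁ i) i j + A G₁ i j - D G₁ i j
            ≈⟨ swap-last (diagonal (λ i → y - deg₁ i) i j) (A G₁ i j) (- D G₁ i j) ⟩
          diagonal (λ i → y - deg₁ i) i j - D G₁ i j + A G₁ i j
            ≈⟨ +-congʳ (diagonal-- (λ i → y - deg₁ i) deg₁ i j) ⟩
          diagonal (λ i → y - deg₁ i - deg₁ i) i j + A G₁ i j
            ≈⟨ +-congʳ (diagonal-cong U-diagonal i j) ⟩
          diagonal (λ i → x - ι (degree G₁ i ℕ.+ n₂ ℕ.+ degree G₁ i)) i j + A G₁ i j ∎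

        P≈ : P ≈ᴹ diagonal (λ i → x - ι (degree G₁ i))
        P≈ = diagonal-- (const x) deg₁

-- Polynomials

open import Data.List.Base using ([]; _∷_)

-- The wrapper makes both sides inferable, which _≈ₚ_ alone does not.
record _≋_ (p q : Poly) : Set where
  constructor mk
  field at : p ≈ₚ q

open _≋_

infix 4 _≋_

coeff-+ : ∀ p q k → coeff (p +ₚ q) k ≡ coeff p k ℚ.+ coeff q k
coeff-+ []      q       k       = ≡.sym (ℚₚ.+-identityˡ _)
coeff-+ (a ∷ p) []      k       = ≡.sym (ℚₚ.+-identityʳ _)
coeff-+ (a ∷ p) (b ∷ q) zero    = ≡.refl
coeff-+ (a ∷ p) (b ∷ q) (suc k) = coeff-+ p q k

coeff-· : ∀ a p k → coeff (a ·ₚ p) k ≡ a ℚ.* coeff p k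
coeff-· a []      k       = ≡.sym (ℚₚ.*-zeroʳ a)
coeff-· a (b ∷ p) zero    = ≡.refl
coeff-· a (b ∷ p) (suc k) = coeff-· a p k

coeff-neg : ∀ p k → coeff (-ₚ p) k ≡ ℚ.- coeff p k
coeff-neg []      k       = ≡.refl
coeff-neg (a ∷ p) zero    = ≡.refl
coeff-neg (a ∷ p) (suc k) = coeff-neg p k

≋-isEquivalence : IsEquivalence _≋_
≋-isEquivalence = record
  { refl  = mk λ k → ≡.refl
  ; sym   = λ p≋q → mk λ k → ≡.sym (at p≋q k)
  ; trans = λ p≋q q≋r → mk λ k → ≡.trans (at p≋q k) (at q≋r k)
  }

+ₚ-cong : ∀ {p p′ q q′} → p ≋ p′ → q ≋ q′ → p +ₚ q ≋ p′ +ₚ q′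
+ₚ-cong {p} {p′} {q} {q′} p≋ q≋ = mk λ k → ≡.trans (coeff-+ p q k)
  (≡.trans (≡.cong₂ ℚ._+_ (at p≋ k) (at q≋ k)) (≡.sym (coeff-+ p′ q′ k)))

+ₚ-assoc : ∀ p q r → (p +ₚ q) +ₚ r ≋ p +ₚ (q +ₚ r)
+ₚ-assoc p q r = mk λ k → begin
  coeff ((p +ₚ q) +ₚ r) k                 ≡⟨ coeff-+ (p +ₚ q) r k ⟩
  coeff (p +ₚ q) k ℚ.+ coeff r k          ≡⟨ ≡.cong (ℚ._+ coeff r k) (coeff-+ p q k) ⟩
  coeff p k ℚ.+ coeff q k ℚ.+ coeff r k   ≡⟨ ℚₚ.+-assoc (coeff p k) (coeff q k) (coeff r k) ⟩
  coeff p k ℚ.+ (coeff q k ℚ.+ coeff r k) ≡⟨ ≡.cong (coeff p k ℚ.+_) (coeff-+ q r k) ⟨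
  coeff p k ℚ.+ coeff (q +ₚ r) k          ≡⟨ coeff-+ p (q +ₚ r) k ⟨
  coeff (p +ₚ (q +ₚ r)) k                 ∎
  where open ≡.≡-Reasoning

+ₚ-comm : ∀ p q → p +ₚ q ≋ q +ₚ p
+ₚ-comm p q = mk λ k → ≡.trans (coeff-+ p q k)
  (≡.trans (ℚₚ.+-comm (coeff p k) (coeff q k)) (≡.sym (coeff-+ q p k)))

+ₚ-identityʳ : ∀ p → p +ₚ [] ≋ p
+ₚ-identityʳ []      = mk λ k → ≡.refl
+ₚ-identityʳ (a ∷ p) = mk λ k → ≡.refl

+ₚ-inverseʳ : ∀ p → p +ₚ (-ₚ p) ≋ []
+ₚ-inverseʳ p = mk λ k → ≡.trans (coeff-+ p (-ₚ p) k)
  (≡.trans (≡.cong (coeff p k ℚ.+_) (coeff-neg p k)) (ℚₚ.+-inverseʳ (coeff p k)))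

-ₚ-cong : ∀ {p q} → p ≋ q → -ₚ p ≋ -ₚ q
-ₚ-cong {p} {q} p≋q = mk λ k → ≡.trans (coeff-neg p k)
  (≡.trans (≡.cong ℚ.-_ (at p≋q k)) (≡.sym (coeff-neg q k)))

+ₚ-abelianGroup : AbelianGroup 0ℓ 0ℓ
+ₚ-abelianGroup = record
  { Carrier = Poly
  ; _≈_     = _≋_
  ; _∙_     = _+ₚ_
  ; ε       = []
  ; _⁻¹     = -ₚ_
  ; isAbelianGroup = record
    { isGroup = record
      { isMonoid = record
        { isSemigroup = record
          { isMagma = record { isEquivalence = ≋-isEquivalence ; ∙-cong = +ₚ-cong }
          ; assoc   = +ₚ-assoc
          }
        ; identity = (λ p → mk λ k → ≡.refl) , +ₚ-identityʳ
        }
      ; inverse = (λ p → IsEquivalence.trans ≋-isEquivalence (+ₚ-comm (-ₚ p) p) (+ₚ-inverseʳ p)) , +ₚ-inverseʳ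
      ; ⁻¹-cong = -ₚ-cong
      }
    ; comm = +ₚ-comm
    }
  }

module PolynomialProduct where

  open AbelianGroup +ₚ-abelianGroup using (refl; sym; trans; setoid; commutativeMonoid)
    renaming (∙-congˡ to +-congˡ; ∙-congʳ to +-congʳ)
  open CommutativeMonoidSolver commutativeMonoid using (solve; _⊕_; _⊜_)
  open import Relation.Binary.Reasoning.Setoid setoid

  ∷-cong : ∀ {a b p q} → a ≡ b → p ≋ q → a ∷ p ≋ b ∷ q
  ∷-cong a≡b p≋q = mk λ { zero → a≡b ; (suc k) → at p≋q k }

  0∷[]≋[] : 0ℚ ∷ [] ≋ []
  0∷[]≋[] = mk λ { zero → ≡.refl ; (suc k) → ≡.refl }

  ·-cong : ∀ a {p q} → p ≋ q → a ·ₚ p ≋ a ·ₚ q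
  ·-cong a {p} {q} p≋q = mk λ k → ≡.trans (coeff-· a p k)
    (≡.trans (≡.cong (a ℚ.*_) (at p≋q k)) (≡.sym (coeff-· a q k)))

  ·-distribˡ : ∀ a p q → a ·ₚ (p +ₚ q) ≋ a ·ₚ p +ₚ a ·ₚ q
  ·-distribˡ a []      q       = refl
  ·-distribˡ a (b ∷ p) []      = refl
  ·-distribˡ a (b ∷ p) (c ∷ q) = ∷-cong (ℚₚ.*-distribˡ-+ a b c) (·-distribˡ a p q)

  ·-distribʳ : ∀ a b p → (a ℚ.+ b) ·ₚ p ≋ a ·ₚ p +ₚ b ·ₚ p
  ·-distribʳ a b []      = refl
  ·-distribʳ a b (c ∷ p) = ∷-cong (ℚₚ.*-distribʳ-+ c a b) (·-distribʳ a b p)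

  ·-assoc : ∀ a b p → (a ℚ.* b) ·ₚ p ≋ a ·ₚ (b ·ₚ p)
  ·-assoc a b []      = refl
  ·-assoc a b (c ∷ p) = ∷-cong (ℚₚ.*-assoc a b c) (·-assoc a b p)

  0·p≋[] : ∀ p → 0ℚ ·ₚ p ≋ []
  0·p≋[] p = mk λ k → ≡.trans (coeff-· 0ℚ p k) (ℚₚ.*-zeroˡ (coeff p k))

  1·p≋p : ∀ p → 1ℚ ·ₚ p ≋ p
  1·p≋p p = mk λ k → ≡.trans (coeff-· 1ℚ p k) (ℚₚ.*-identityˡ (coeff p k))

  *-congˡ : ∀ p {q r} → q ≋ r → p *ₚ q ≋ p *ₚ r
  *-congˡ []      q≋r = refl
  *-congˡ (a ∷ p) q≋r = +ₚ-cong (·-cong a q≋r) (∷-cong ≡.refl (*-congˡ p q≋r))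

  *-zeroʳ : ∀ p → p *ₚ [] ≋ []
  *-zeroʳ []      = refl
  *-zeroʳ (a ∷ p) = trans (∷-cong ≡.refl (*-zeroʳ p)) 0∷[]≋[]

  -- The defining recursion of `*ₚ` transferred to the right factor; with it, commutativity is an
  -- induction on one factor.
  *-∷ : ∀ p b q → p *ₚ (b ∷ q) ≋ b ·ₚ p +ₚ (0ℚ ∷ p *ₚ q)
  *-∷ []      b q = sym 0∷[]≋[]
  *-∷ (a ∷ p) b q = ∷-cong (≡.cong (ℚ._+ 0ℚ) (ℚₚ.*-comm a b)) (begin
    a ·ₚ q +ₚ p *ₚ (b ∷ q)
      ≈⟨ +-congˡ (*-∷ p b q) ⟩
    a ·ₚ q +ₚ (b ·ₚ p +ₚ (0ℚ ∷ p *ₚ q))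
      ≈⟨ solve 3 (λ x y z → x ⊕ (y ⊕ z) ⊜ y ⊕ (x ⊕ z)) refl (a ·ₚ q) (b ·ₚ p) (0ℚ ∷ p *ₚ q) ⟩
    b ·ₚ p +ₚ (a ·ₚ q +ₚ (0ℚ ∷ p *ₚ q)) ∎)

  *-comm : ∀ p q → p *ₚ q ≋ q *ₚ p
  *-comm []      q = sym (*-zeroʳ q)
  *-comm (a ∷ p) q = trans (+-congˡ (∷-cong ≡.refl (*-comm p q))) (sym (*-∷ q a p))

  -- Equal polynomials may be lists of different lengths, so recursion on the left factor does not
  -- match p with `p′`. Commutativity moves the change into the right factor.
  *-cong : ∀ {p p′ q q′} → p ≋ p′ → q ≋ q′ → p *ₚ q ≋ p′ *ₚ q′
  *-cong {p} {p′} {q} {q′} p≋ q≋ = begin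
    p *ₚ q    ≈⟨ *-congˡ p q≋ ⟩
    p *ₚ q′   ≈⟨ *-comm p q′ ⟩
    q′ *ₚ p   ≈⟨ *-congˡ q′ p≋ ⟩
    q′ *ₚ p′  ≈⟨ *-comm q′ p′ ⟩
    p′ *ₚ q′  ∎

  *-distribʳ : ∀ r p q → (p +ₚ q) *ₚ r ≋ p *ₚ r +ₚ q *ₚ r
  *-distribʳ r []      q       = refl
  *-distribʳ r (a ∷ p) []      = sym (+ₚ-identityʳ _)
  *-distribʳ r (a ∷ p) (b ∷ q) = begin
    (a ℚ.+ b) ·ₚ r +ₚ (0ℚ ∷ (p +ₚ q) *ₚ r)
      ≈⟨ +ₚ-cong (·-distribʳ a b r) (∷-cong ≡.refl (*-distribʳ r p q)) ⟩
    a ·ₚ r +ₚ b ·ₚ r +ₚ ((0ℚ ∷ p *ₚ r) +ₚ (0ℚ ∷ q *ₚ r))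
      ≈⟨ solve 4 (λ x y z w → (x ⊕ y) ⊕ (z ⊕ w) ⊜ (x ⊕ z) ⊕ (y ⊕ w))
           refl (a ·ₚ r) (b ·ₚ r) (0ℚ ∷ p *ₚ r) (0ℚ ∷ q *ₚ r) ⟩
    (a ·ₚ r +ₚ (0ℚ ∷ p *ₚ r)) +ₚ (b ·ₚ r +ₚ (0ℚ ∷ q *ₚ r)) ∎

  *-distribˡ : ∀ r p q → r *ₚ (p +ₚ q) ≋ r *ₚ p +ₚ r *ₚ q
  *-distribˡ r p q = trans (*-comm r (p +ₚ q))
    (trans (*-distribʳ r p q) (+ₚ-cong (*-comm p r) (*-comm q r)))

  ·-*-assoc : ∀ a p q → (a ·ₚ p) *ₚ q ≋ a ·ₚ (p *ₚ q)
  ·-*-assoc a []      q = refl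
  ·-*-assoc a (b ∷ p) q = begin
    (a ℚ.* b) ·ₚ q +ₚ (0ℚ ∷ (a ·ₚ p) *ₚ q)
      ≈⟨ +ₚ-cong (·-assoc a b q) (∷-cong (≡.sym (ℚₚ.*-zeroʳ a)) (·-*-assoc a p q)) ⟩
    a ·ₚ (b ·ₚ q) +ₚ a ·ₚ (0ℚ ∷ p *ₚ q)
      ≈⟨ ·-distribˡ a (b ·ₚ q) (0ℚ ∷ p *ₚ q) ⟨
    a ·ₚ (b ·ₚ q +ₚ (0ℚ ∷ p *ₚ q)) ∎

  *-assoc : ∀ p q r → (p *ₚ q) *ₚ r ≋ p *ₚ (q *ₚ r)
  *-assoc []      q r = refl
  *-assoc (a ∷ p) q r = begin
    (a ·ₚ q +ₚ (0ℚ ∷ p *ₚ q)) *ₚ r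
      ≈⟨ *-distribʳ r (a ·ₚ q) (0ℚ ∷ p *ₚ q) ⟩
    (a ·ₚ q) *ₚ r +ₚ (0ℚ ·ₚ r +ₚ (0ℚ ∷ (p *ₚ q) *ₚ r))
      ≈⟨ +ₚ-cong (·-*-assoc a q r) (+-congʳ (0·p≋[] r)) ⟩
    a ·ₚ (q *ₚ r) +ₚ (0ℚ ∷ (p *ₚ q) *ₚ r)
      ≈⟨ +-congˡ (∷-cong ≡.refl (*-assoc p q r)) ⟩
    a ·ₚ (q *ₚ r) +ₚ (0ℚ ∷ p *ₚ (q *ₚ r)) ∎

  *-identityˡ : ∀ p → (1ℚ ∷ []) *ₚ p ≋ p
  *-identityˡ p = trans (+ₚ-cong (1·p≋p p) 0∷[]≋[]) (+ₚ-identityʳ p)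

polynomialRing : CommutativeRing 0ℓ 0ℓ
polynomialRing = record
  { Carrier = Poly
  ; _≈_     = _≋_
  ; _+_     = _+ₚ_
  ; _*_     = _*ₚ_
  ; -_      = -ₚ_
  ; 0#      = []
  ; 1#      = 1ℚ ∷ []
  ; isCommutativeRing = record
    { isRing = record
      { +-isAbelianGroup = AbelianGroup.isAbelianGroup +ₚ-abelianGroup
      ; *-cong     = *-cong
      ; *-assoc    = *-assoc
      ; *-identity = *-identityˡ , λ p → trans (*-comm p (1ℚ ∷ [])) (*-identityˡ p)
      ; distrib    = *-distribˡ , *-distribʳ
      }
    ; *-comm = *-comm
    }
  }
  where
  open PolynomialProduct
  open AbelianGroup +ₚ-abelianGroup using (trans)

-- The ring of rational functions and leading terms in it

module RationalFunctions where

  open CommutativeRing polynomialRing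
  open import Algebra.Properties.Ring ring using (-‿distribˡ-*; [y-z]x≈yx-zx)
  open import Algebra.Properties.AbelianGroup +ₚ-abelianGroup using () renaming (x∙y⁻¹≈ε⇒x≈y to x-y≈0⇒x≈y)
  open import Algebra.Solver.Ring.NaturalCoefficients.Default commutativeSemiring
    using (solve; _:=_; _:+_; _:*_)
  open import Relation.Binary.Reasoning.Setoid setoid

  NonZeroₚ-resp-≋ : ∀ {p q} → p ≋ q → NonZeroₚ p → NonZeroₚ q
  NonZeroₚ-resp-≋ p≋q (k , p≢0) = k , λ q≡0 → p≢0 (≡.trans (at p≋q k) q≡0)

  ¬NonZeroₚ⇒≋[] : ∀ {p} → ¬ NonZeroₚ p → p ≋ []
  ¬NonZeroₚ⇒≋[] {p} ¬nz = mk λ k → decidable-stable (coeff p k ℚₚ.≟ 0ℚ) λ p≢0 → ¬nz (k , p≢0)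

  -- ℚ[X] has no zero divisors: were p - q nonzero, (p - q) r would be nonzero too, but it vanishes.
  -- Decidability of equality in ℚ turns the contradiction into an equality of coefficients.
  *-cancelʳ : ∀ {p q} r → NonZeroₚ r → p * r ≋ q * r → p ≋ q
  *-cancelʳ {p} {q} r r-nz eq = x-y≈0⇒x≈y p q (¬NonZeroₚ⇒≋[] λ p-q-nz →
    let k , [p-q]r≢0 = *ₚ-nonZero (p - q) r p-q-nz r-nz in
    [p-q]r≢0 (at (begin
      (p - q) * r    ≈⟨ [y-z]x≈yx-zx r p q ⟩
      p * r - q * r  ≈⟨ +-congʳ eq ⟩
      q * r - q * r  ≈⟨ -‿inverseʳ (q * r) ⟩
      []             ∎) k))

  open RawRing ℚ⟨X⟩ using () renaming
    (_≈_ to _≈ᶠ_; _+_ to _+ᶠ_; _*_ to _*ᶠ_; -_ to -ᶠ_; 0# to 0ᶠ; 1# to 1ᶠ)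

  ≈ᶠ-isEquivalence : IsEquivalence _≈ᶠ_
  ≈ᶠ-isEquivalence = record
    { refl  = λ k → ≡.refl
    ; sym   = λ f≈g k → ≡.sym (f≈g k)
    -- Cross-multiplied equations compose only after multiplication by `den g`, which then has to be
    -- cancelled; the nonzero denominator is what makes this possible.
    ; trans = λ {f} {g} {h} f≈g g≈h → at (*-cancelʳ {num f * den h} {num h * den f} (den g) (den-nz g) (begin
        (num f * den h) * den g  ≈⟨ solve 3 (λ a e d → (a :* e) :* d := (a :* d) :* e) refl (num f) (den h) (den g) ⟩
        (num f * den g) * den h  ≈⟨ *-congʳ (mk {num f * den g} {num g * den f} f≈g) ⟩
        (num g * den f) * den h  ≈⟨ solve 3 (λ a e d → (a :* e) :* d := (a :* d) :* e) refl (num g) (den f) (den h) ⟩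
        (num g * den h) * den f  ≈⟨ *-congʳ (mk {num g * den h} {num h * den g} g≈h) ⟩
        (num h * den g) * den f  ≈⟨ solve 3 (λ a e d → (a :* e) :* d := (a :* d) :* e) refl (num h) (den g) (den f) ⟩
        (num h * den f) * den g  ∎))
    }

  +ᶠ-cong : ∀ f f′ g g′ → f ≈ᶠ f′ → g ≈ᶠ g′ → f +ᶠ g ≈ᶠ f′ +ᶠ g′
  +ᶠ-cong (a / d [ _ ]) (a′ / d′ [ _ ]) (b / e [ _ ]) (b′ / e′ [ _ ]) f≈ g≈ = at (begin
    (a * e + b * d) * (d′ * e′)
      ≈⟨ solve 6 (λ a b d e d′ e′ → (a :* e :+ b :* d) :* (d′ :* e′) :=
           (a :* d′) :* (e :* e′) :+ (b :* e′) :* (d :* d′)) refl a b d e d′ e′ ⟩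
    (a * d′) * (e * e′) + (b * e′) * (d * d′)
      ≈⟨ +-cong (*-congʳ (mk {a * d′} {a′ * d} f≈)) (*-congʳ (mk {b * e′} {b′ * e} g≈)) ⟩
    (a′ * d) * (e * e′) + (b′ * e) * (d * d′)
      ≈⟨ solve 6 (λ a b d e d′ e′ → (a :* d) :* (e :* e′) :+ (b :* e) :* (d :* d′) :=
           (a :* e′ :+ b :* d′) :* (d :* e)) refl a′ b′ d e d′ e′ ⟩
    (a′ * e′ + b′ * d′) * (d * e) ∎)

  *ᶠ-cong : ∀ f f′ g g′ → f ≈ᶠ f′ → g ≈ᶠ g′ → f *ᶠ g ≈ᶠ f′ *ᶠ g′
  *ᶠ-cong (a / d [ _ ]) (a′ / d′ [ _ ]) (b / e [ _ ]) (b′ / e′ [ _ ]) f≈ g≈ = at (begin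
    (a * b) * (d′ * e′)  ≈⟨ interchange a b d′ e′ ⟩
    (a * d′) * (b * e′)  ≈⟨ *-cong (mk {a * d′} {a′ * d} f≈) (mk {b * e′} {b′ * e} g≈) ⟩
    (a′ * d) * (b′ * e)  ≈⟨ interchange a′ d b′ e ⟩
    (a′ * b′) * (d * e)  ∎)
    where
    interchange = solve 4 (λ a b c d → (a :* b) :* (c :* d) := (a :* c) :* (b :* d)) refl

  -ᶠ-cong : ∀ f g → f ≈ᶠ g → -ᶠ f ≈ᶠ -ᶠ g
  -ᶠ-cong (a / d [ _ ]) (b / e [ _ ]) f≈g = at (begin
    - a * e    ≈⟨ -‿distribˡ-* a e ⟨
    - (a * e)  ≈⟨ -‿cong (mk {a * e} {b * d} f≈g) ⟩
    - (b * d)  ≈⟨ -‿distribˡ-* b d ⟩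
    - b * d    ∎)

  +ᶠ-comm : ∀ f g → f +ᶠ g ≈ᶠ g +ᶠ f
  +ᶠ-comm (a / d [ _ ]) (b / e [ _ ]) = at (solve 4 (λ a b d e →
    (a :* e :+ b :* d) :* (e :* d) := (b :* d :+ a :* e) :* (d :* e)) refl a b d e)

  *ᶠ-comm : ∀ f g → f *ᶠ g ≈ᶠ g *ᶠ f
  *ᶠ-comm (a / d [ _ ]) (b / e [ _ ]) = at (solve 4 (λ a b d e →
    (a :* b) :* (e :* d) := (b :* a) :* (d :* e)) refl a b d e)

  +ᶠ-identityˡ : ∀ f → 0ᶠ +ᶠ f ≈ᶠ f
  +ᶠ-identityˡ (a / d [ _ ]) = at (begin
    ([] + a * (1ℚ ∷ [])) * d  ≈⟨ *-congʳ (+-identityˡ (a * (1ℚ ∷ []))) ⟩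
    (a * (1ℚ ∷ [])) * d       ≈⟨ *-assoc a (1ℚ ∷ []) d ⟩
    a * ((1ℚ ∷ []) * d)       ∎)

  *ᶠ-identityˡ : ∀ f → 1ᶠ *ᶠ f ≈ᶠ f
  *ᶠ-identityˡ (a / d [ _ ]) = at (solve 3 (λ o a d → (o :* a) :* d := a :* (o :* d)) refl (1ℚ ∷ []) a d)

  +ᶠ-inverseˡ : ∀ f → (-ᶠ f) +ᶠ f ≈ᶠ 0ᶠ
  +ᶠ-inverseˡ (a / d [ _ ]) = at (begin
    (- a * d + a * d) * (1ℚ ∷ [])  ≈⟨ *-identityʳ (- a * d + a * d) ⟩
    - a * d + a * d                ≈⟨ distribʳ d (- a) a ⟨
    (- a + a) * d                  ≈⟨ *-congʳ (-‿inverseˡ a) ⟩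
    []                             ∎)

  +ᶠ-assoc : ∀ f g h → (f +ᶠ g) +ᶠ h ≈ᶠ f +ᶠ (g +ᶠ h)
  +ᶠ-assoc (a / d [ _ ]) (b / e [ _ ]) (c / f [ _ ]) = at (solve 6 (λ a b c d e f →
    ((a :* e :+ b :* d) :* f :+ c :* (d :* e)) :* (d :* (e :* f)) :=
    (a :* (e :* f) :+ (b :* f :+ c :* e) :* d) :* ((d :* e) :* f)) refl a b c d e f)

  *ᶠ-assoc : ∀ f g h → (f *ᶠ g) *ᶠ h ≈ᶠ f *ᶠ (g *ᶠ h)
  *ᶠ-assoc (a / d [ _ ]) (b / e [ _ ]) (c / f [ _ ]) = at (solve 6 (λ a b c d e f →
    ((a :* b) :* c) :* (d :* (e :* f)) := (a :* (b :* c)) :* ((d :* e) :* f)) refl a b c d e f)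

  *ᶠ-distribˡ : ∀ f g h → f *ᶠ (g +ᶠ h) ≈ᶠ f *ᶠ g +ᶠ f *ᶠ h
  *ᶠ-distribˡ (a / d [ _ ]) (b / e [ _ ]) (c / f [ _ ]) = at (solve 6 (λ a b c d e f →
    (a :* (b :* f :+ c :* e)) :* ((d :* e) :* (d :* f)) :=
    ((a :* b) :* (d :* f) :+ (a :* c) :* (d :* e)) :* (d :* (e :* f))) refl a b c d e f)

  ℚ⟨X⟩-commutativeRing : CommutativeRing 0ℓ 0ℓ
  ℚ⟨X⟩-commutativeRing = record
    { RawRing ℚ⟨X⟩
    ; isCommutativeRing = record
      { isRing = record
        { +-isAbelianGroup = record
          { isGroup = record
            { isMonoid = record
              { isSemigroup = record
                { isMagma = record
                  { isEquivalence = ≈ᶠ-isEquivalence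
                  ; ∙-cong = λ {f} {f′} {g} {g′} → +ᶠ-cong f f′ g g′
                  }
                ; assoc = +ᶠ-assoc
                }
              ; identity = +ᶠ-identityˡ , λ f → IsEquivalence.trans ≈ᶠ-isEquivalence {f +ᶠ 0ᶠ} {0ᶠ +ᶠ f} {f}
                  (+ᶠ-comm f 0ᶠ) (+ᶠ-identityˡ f)
              }
            ; inverse = +ᶠ-inverseˡ , λ f → IsEquivalence.trans ≈ᶠ-isEquivalence {f +ᶠ (-ᶠ f)} {(-ᶠ f) +ᶠ f} {0ᶠ}
                (+ᶠ-comm f (-ᶠ f)) (+ᶠ-inverseˡ f)
            ; ⁻¹-cong = λ {f} {g} → -ᶠ-cong f g
            }
          ; comm = +ᶠ-comm
          }
        ; *-cong     = λ {f} {f′} {g} {g′} → *ᶠ-cong f f′ g g′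
        ; *-assoc    = *ᶠ-assoc
        ; *-identity = *ᶠ-identityˡ , λ f → IsEquivalence.trans ≈ᶠ-isEquivalence {f *ᶠ 1ᶠ} {1ᶠ *ᶠ f} {f}
            (*ᶠ-comm f 1ᶠ) (*ᶠ-identityˡ f)
        ; distrib    = *ᶠ-distribˡ , λ h f g → IsEquivalence.trans ≈ᶠ-isEquivalence
            {(f +ᶠ g) *ᶠ h} {h *ᶠ (f +ᶠ g)} {f *ᶠ h +ᶠ g *ᶠ h} (*ᶠ-comm (f +ᶠ g) h)
            (IsEquivalence.trans ≈ᶠ-isEquivalence {h *ᶠ (f +ᶠ g)} {h *ᶠ f +ᶠ h *ᶠ g} {f *ᶠ h +ᶠ g *ᶠ h}
              (*ᶠ-distribˡ h f g)
              (+ᶠ-cong (h *ᶠ f) (f *ᶠ h) (h *ᶠ g) (g *ᶠ h) (*ᶠ-comm h f) (*ᶠ-comm h g)))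
        }
      ; *-comm = *ᶠ-comm
      }
    }

  reciprocal : ∀ f → NonZeroₚ (num f) → Σ[ u ∈ RatFun ] f *ᶠ u ≈ᶠ 1ᶠ
  reciprocal (a / d [ d-nz ]) a-nz = (d / a [ a-nz ]) ,
    at (solve 3 (λ a d o → (a :* d) :* o := o :* (d :* a)) refl a d (1ℚ ∷ []))

  -- A fraction counts as a polynomial when it equals one, whatever denominator the ring operations
  -- have left on it. The degree is bounded through coefficients and not list length, as trailing
  -- zeros are allowed; a may be zero.
  record LeadingTerm (n : ℕ) (a : ℚ) (f : RatFun) : Set where
    constructor leadingTerm
    field
      poly        : Poly
      represents  : f ≈ᶠ polynomial poly
      coefficient : coeff poly n ≡ a
      bounded     : ∀ k → n ℕ.< k → coeff poly k ≡ 0ℚ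

  -- By recursion on m, removing the constant coefficient a of p: the product of a with q has degree
  -- at most n and cannot reach the position in question, so only the shifted product with the rest
  -- of p contributes.
  coeff-*-top : ∀ m n p q → (∀ k → m ℕ.< k → coeff p k ≡ 0ℚ) → (∀ k → n ℕ.< k → coeff q k ≡ 0ℚ) →
                coeff (p *ₚ q) (m ℕ.+ n) ≡ coeff p m ℚ.* coeff q n
  coeff-*-bounded : ∀ m n p q → (∀ k → m ℕ.< k → coeff p k ≡ 0ℚ) → (∀ k → n ℕ.< k → coeff q k ≡ 0ℚ) →
                    ∀ k → m ℕ.+ n ℕ.< k → coeff (p *ₚ q) k ≡ 0ℚ

  coeff-∷-* : ∀ a p q k → coeff ((a ∷ p) *ₚ q) k ≡ a ℚ.* coeff q k ℚ.+ coeff (0ℚ ∷ p *ₚ q) k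
  coeff-∷-* a p q k = ≡.trans (coeff-+ (a ·ₚ q) (0ℚ ∷ p *ₚ q) k)
    (≡.cong (ℚ._+ coeff (0ℚ ∷ p *ₚ q) k) (coeff-· a q k))

  coeff-constant-* : ∀ a p q → (∀ k → coeff p k ≡ 0ℚ) → ∀ k → coeff ((a ∷ p) *ₚ q) k ≡ a ℚ.* coeff q k
  coeff-constant-* a p q p≡0 k = ≡.trans (coeff-∷-* a p q k)
    (≡.trans (≡.cong (a ℚ.* coeff q k ℚ.+_) (shift k)) (ℚₚ.+-identityʳ _))
    where
    shift : ∀ k → coeff (0ℚ ∷ p *ₚ q) k ≡ 0ℚ
    shift zero    = ≡.refl
    shift (suc k) = at (*-congʳ {q} {p} {[]} (mk p≡0)) k

  coeff-*-top m       n []      q p-bd q-bd = ≡.sym (ℚₚ.*-zeroˡ (coeff q n))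
  coeff-*-top zero    n (a ∷ p) q p-bd q-bd = coeff-constant-* a p q (λ k → p-bd (suc k) (ℕ.s≤s ℕ.z≤n)) n
  coeff-*-top (suc m) n (a ∷ p) q p-bd q-bd = ≡.trans (coeff-∷-* a p q (suc m ℕ.+ n))
    (≡.trans (≡.cong₂ ℚ._+_
        (≡.trans (≡.cong (a ℚ.*_) (q-bd (suc m ℕ.+ n) (ℕ.s≤s (ℕₚ.m≤n+m n m)))) (ℚₚ.*-zeroʳ a))
        (coeff-*-top m n p q (λ k m<k → p-bd (suc k) (ℕ.s≤s m<k)) q-bd))
      (ℚₚ.+-identityˡ _))

  coeff-*-bounded m       n []      q p-bd q-bd k       m+n<k = ≡.refl
  coeff-*-bounded zero    n (a ∷ p) q p-bd q-bd k       n<k   = ≡.trans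
    (coeff-constant-* a p q (λ k → p-bd (suc k) (ℕ.s≤s ℕ.z≤n)) k)
    (≡.trans (≡.cong (a ℚ.*_) (q-bd k n<k)) (ℚₚ.*-zeroʳ a))
  coeff-*-bounded (suc m) n (a ∷ p) q p-bd q-bd (suc k) (ℕ.s≤s m+n<k) = ≡.trans (coeff-∷-* a p q (suc k))
    (≡.trans (≡.cong₂ ℚ._+_
        (≡.trans (≡.cong (a ℚ.*_) (q-bd (suc k)
          (ℕₚ.<-≤-trans (ℕ.s≤s (ℕₚ.m≤n+m n m)) (ℕₚ.m≤n⇒m≤1+n m+n<k)))) (ℚₚ.*-zeroʳ a))
        (coeff-*-bounded m n p q (λ k m<k → p-bd (suc k) (ℕ.s≤s m<k)) q-bd k m+n<k))
      (ℚₚ.+-identityˡ _))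

  private module F = CommutativeRing ℚ⟨X⟩-commutativeRing

  polynomial-+ : ∀ p q → polynomial p +ᶠ polynomial q ≈ᶠ polynomial (p +ₚ q)
  polynomial-+ p q = at (solve 3 (λ p q o → (p :* o :+ q :* o) :* o := (p :+ q) :* (o :* o)) refl p q (1ℚ ∷ []))

  polynomial-* : ∀ p q → polynomial p *ᶠ polynomial q ≈ᶠ polynomial (p *ₚ q)
  polynomial-* p q = at (*-congˡ {p *ₚ q} (sym (*-identityˡ (1ℚ ∷ []))))

  leadingTerm-isLeading : LeadingCoefficients.IsLeading ℚₚ.+-*-commutativeRing ℚ⟨X⟩-commutativeRing LeadingTerm
  leadingTerm-isLeading = record
    { resp  = λ { {x = f} {y = g} ≡.refl f≈g (leadingTerm p f≈p top bd) →
        leadingTerm p (F.trans {g} {f} {polynomial p} (F.sym {f} {g} f≈g) f≈p) top bd }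
    ; plus  = λ { {n} {x = f} {y = g} (leadingTerm p f≈p p-top p-bd) (leadingTerm q g≈q q-top q-bd) →
        leadingTerm (p +ₚ q)
          (F.trans {f +ᶠ g} {polynomial p +ᶠ polynomial q} {polynomial (p +ₚ q)}
            (+ᶠ-cong f (polynomial p) g (polynomial q) f≈p g≈q) (polynomial-+ p q))
          (≡.trans (coeff-+ p q n) (≡.cong₂ ℚ._+_ p-top q-top))
          (λ k n<k → ≡.trans (coeff-+ p q k) (≡.cong₂ ℚ._+_ (p-bd k n<k) (q-bd k n<k))) }
    ; times = λ { {m} {n} {x = f} {y = g} (leadingTerm p f≈p p-top p-bd) (leadingTerm q g≈q q-top q-bd) →
        leadingTerm (p *ₚ q)
          (F.trans {f *ᶠ g} {polynomial p *ᶠ polynomial q} {polynomial (p *ₚ q)}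
            (*ᶠ-cong f (polynomial p) g (polynomial q) f≈p g≈q) (polynomial-* p q))
          (≡.trans (coeff-*-top m n p q p-bd q-bd) (≡.cong₂ ℚ._*_ p-top q-top))
          (coeff-*-bounded m n p q p-bd q-bd) }
    ; minus = λ { {n} {x = f} (leadingTerm p f≈p p-top p-bd) →
        leadingTerm (-ₚ p) (-ᶠ-cong f (polynomial p) f≈p)
          (≡.trans (coeff-neg p n) (≡.cong ℚ.-_ p-top))
          (λ k n<k → ≡.trans (coeff-neg p k) (≡.cong ℚ.-_ (p-bd k n<k))) }
    ; one   = leadingTerm (1ℚ ∷ []) (F.refl {1ᶠ}) ≡.refl λ { (suc k) _ → ≡.refl }
    ; nil   = leadingTerm [] (F.refl {0ᶠ}) ≡.refl λ _ _ → ≡.refl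
    ; raise = λ { {n} (leadingTerm p f≈p p-top p-bd) →
        leadingTerm p f≈p (p-bd (suc n) (ℕₚ.n<1+n n)) λ k 1+n<k → p-bd k (ℕₚ.<-trans (ℕₚ.n<1+n n) 1+n<k) }
    }

  -- Inverting a fraction requires its numerator to be nonzero. As f equals the polynomial p,
  -- `num f` is p times `den f`, a product of two nonzero polynomials.
  monic⇒unit : ∀ {n f} → LeadingTerm n 1ℚ f → Σ[ u ∈ RatFun ] f *ᶠ u ≈ᶠ 1ᶠ
  monic⇒unit {n} {f} (leadingTerm p f≈p top _) = reciprocal f (NonZeroₚ-resp-≋
    (trans (sym (mk {num f * (1ℚ ∷ [])} {p * den f} f≈p)) (*-identityʳ (num f)))
    (*ₚ-nonZero p (den f) (n , λ p≡0 → 1≢0 (≡.trans (≡.sym top) p≡0)) (den-nz f)))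
    where
    1≢0 : 1ℚ ≢ 0ℚ
    1≢0 ()

  X-leadingTerm : LeadingTerm 1 1ℚ X
  X-leadingTerm = leadingTerm (0ℚ ∷ 1ℚ ∷ []) (F.refl {X}) ≡.refl λ
    { (suc zero) (ℕ.s≤s ()) ; (suc (suc k)) _ → ≡.refl }

-- Specialisation to ℚ(X) and the indeterminate X

open import Defs

theorem4p2 :
  ∀ (n₁ n₂ : ℕ) (G₁ : Graph n₁) (G₂ : Graph n₂) →
    (Σ[ P ∈ Invertible ((X - ι n₁ + 1#) ·I +ᴹ D G₁) ]
     let M = L G₁ -ᴹ D G₁ +ᴹ A (complement G₁) *ᴹ P ⁻¹ *ᴹ A (complement G₁) in
     Σ[ Q ∈ Invertible ((X - ι n₁) ·I -ᴹ L G₂) ]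
     Σ[ S ∈ Invertible ((X - ι n₁ - ι n₂ + 1#) ·I -ᴹ M) ]
       f (L (G₁ NNS∨ G₂)) ≈
           det ((X - ι n₁) ·I -ᴹ L G₂)
         * det ((X - ι n₁ + 1#) ·I +ᴹ D G₁)
         * det ((X - ι n₁ - ι n₂ + 1#) ·I -ᴹ L G₁ +ᴹ D G₁ -ᴹ A (complement G₁) *ᴹ P ⁻¹ *ᴹ A (complement G₁))
         * (1# - Γ (L G₂) (X - ι n₁) Q * Γ M (X - ι n₁ - ι n₂ + 1#) S))
    ×
    (Σ[ P ∈ Invertible (X ·I -ᴹ D G₁) ]
     let M = L G₁ +ᴹ D G₁ +ᴹ A G₁ *ᴹ P ⁻¹ *ᴹ A G₁ in
     Σ[ Q ∈ Invertible ((X - ι n₁) ·I -ᴹ L G₂) ]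
     Σ[ S ∈ Invertible ((X - ι n₂) ·I -ᴹ M) ]
       f (L (G₁ NS∨ G₂)) ≈
           det ((X - ι n₁) ·I -ᴹ L G₂)
         * det (X ·I -ᴹ D G₁)
         * det ((X - ι n₂) ·I -ᴹ L G₁ -ᴹ D G₁ -ᴹ A G₁ *ᴹ P ⁻¹ *ᴹ A G₁)
         * (1# - Γ (L G₂) (X - ι n₁) Q * Γ M (X - ι n₂) S))
theorem4p2 n₁ n₂ G₁ G₂ = NNS-join leadingTerm-isLeading monic⇒unit X-leadingTerm G₁ G₂ ,
                         NS-join leadingTerm-isLeading monic⇒unit X-leadingTerm G₁ G₂
  where
  open RationalFunctions
  open LeadingCoefficients ℚₚ.+-*-commutativeRing ℚ⟨X⟩-commutativeRing
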